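{- Let $(\mathcal{C},\mathsf{I},\otimes,\lambda,\rho,\alpha)$ be a monoidal category with finite products, $\mathsf{T}=(T,\eta,\mu)$ a monoid in it, and $(\mathcal{E},\mathcal{M})$ an orthogonal factorization system on $\mathcal{C}$ such that: $\mathcal{E}$ is closed under $(-)\otimes S$ for every object $(S,s)$ of $\mathcal{M}/T$; the skew monoidal category $\mathcal{M}/\mathsf{T}=(\mathcal{M}/T,\mathsf{J},\boxdot)$ is monoidal; $\mathcal{E}$ contains all canonical morphisms $\langle\pi_i\otimes Y\rangle_i:(\prod_iX_i)\otimes Y\to\prod_i(X_i\otimes Y)$; and $\mathcal{E}$ is closed under finite products. Let $\phi:T^n\to T$ be an $n$-ary algebraic operation for $\mathsf{T}$ and $(R_1,r_1),\dots,(R_n,r_n)$ objects of $\mathcal{M}/T$. Factor $\phi\circ\prod_i r_i = r'\circ p$ with $p:\prod_iR_i\to R'$ in $\mathcal{E}$ and $r':R'\to T$ in $\mathcal{M}$. For each object $(S,s)$ of $\mathcal{M}/T$ let $\psi_S:\prod_i(R_i\boxdot S)\to R'\boxdot S$ be the unique morphism with $\psi_S\circ\prod_i q_{R_i,S}\circ\langle\pi_i\otimes S\rangle_i = q_{R',S}\circ(p\otimes S)$ and $(r'\boxdot s)\circ\psi_S = \phi\circ\prod_i(r_i\boxdot s)$. Then: (1) $\psi$ is an $(R_1,\dots,R_n;R')$-ary algebraic operation for the graded monoid $T_{\mathcal{M}}$, $\psi$ grades $\phi$, and every component $\psi_S$ is in $\mathcal{E}$. (2) For every object $(R'',r'')$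 of $\mathcal{M}/T$ and every $(R_1,\dots,R_n;R'')$-ary algebraic operation $\psi'$ for $T_{\mathcal{M}}$ that grades $\phi$, there is a unique morphism $f:(R',r')\to(R'',r'')$ in $\mathcal{M}/T$ such that $(f\boxdot S)\circ\psi_S=\psi'_S$ for all objects $S$ of $\mathcal{M}/T$.
   Context: Orthogonal factorization system $(\mathcal{E},\mathcal{M})$: both classes contain isomorphisms and are closed under composition; every commuting square $g e = m f$ with $e\in\mathcal{E}$, $m\in\mathcal{M}$ has a unique diagonal $d$ ($de=f$, $md=g$); every morphism factors as $m\circ e$. A monoid: $\eta:\mathsf{I}\to T$, $\mu:T\otimes T\to T$ with the usual unit and associativity laws. $\mathcal{M}/T$: objects $(S,s)$ with $s:S\to T$ in $\mathcal{M}$; morphisms $f:(S,s)\to(S',s')$ with $s'f=s$. Factor $\eta=j\circ q$ with $q:\mathsf{I}\to\mathsf{J}$ in $\mathcal{E}$, $j$ in $\mathcal{M}$; factor $\mu\circ(s\otimes s')=(s\boxdot s')\circ q_{S,S'}$ with $q_{S,S'}:S\otimes S'\to S\boxdot S'$ in $\mathcal{E}$, $s\boxdot s'$ in $\mathcal{M}$. This gives a skew monoidal structure $(\mathcal{M}/T,(\mathsf{J},j),\boxdot)$, denoted $\mathcal{M}/\mathsf{T}$, whose action on morphisms and structure maps are the unique diagonals compatible with the $q$'s and the structure maps of $\mathcal{C}$; in particular $f\boxdot f'$ is the unique morphism with $(f\boxdot f')q_{S_1,S_1'}=q_{S_2,S_2'}(f\otimes f')$ commuting with the maps to $T$, the right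 unitor is $r_S=q_{S,\mathsf{J}}\circ(S\otimes q)\circ\rho_S$, and the associator $a$ satisfies $a\,q_{S\boxdot S',S''}(q_{S,S'}\otimes S'')=q_{S,S'\boxdot S''}(S\otimes q_{S',S''})\alpha_{S,S',S''}$. The graded monoid (lax monoidal functor) $T_{\mathcal{M}}:\mathcal{M}/\mathsf{T}\to\mathcal{C}$ sends $(S,s)\mapsto S$ with unit $q$ and multiplication $q_{S,S'}$. An $n$-ary algebraic operation for $\mathsf{T}$ is $\phi:T^n\to T$ with $\phi\circ\mu^n\circ\langle\pi_i\otimes T\rangle_i=\mu\circ(\phi\otimes T)$. For a lax monoidal functor $(G,\eta^G,\mu^G):(\mathcal{G},I,\odot)\to\mathcal{C}$ from a monoidal category with associator $\alpha^{\mathcal{G}}$, a $(d_1,\dots,d_n;d')$-ary algebraic operation is a natural family $\psi_e:\prod_iG(d_i\odot e)\to G(d'\odot e)$ such that for all $e,e'$: $\psi_{e\odot e'}\circ\prod_iG(\alpha^{\mathcal{G}})\circ\prod_i\mu^G_{d_i\odot e,e'}\circ\langle\pi_i\otimes Ge'\rangle_i = G(\alpha^{\mathcal{G}})\circ\mu^G_{d'\odot e,e'}\circ(\psi_e\otimes Ge')$. For a grading with $\mathcal{M}$-components $g_d:Gd\to T$, $\psi$ grades $\phi$ if $g_{d'\odot e}\circ\psi_e=\phi\circ\prod_ig_{d_i\odot e}$ for all $e$; for $T_{\mathcal{M}}$, $g_{(S,s)}=s$. -}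

module Defs where

open import Level using (Level; suc; _⊔_)
open import Data.Nat.Base using (ℕ)
open import Data.Fin.Base using (Fin)
open import Data.Product using (∃!; _×_; _,_; proj₁; proj₂)
open import Relation.Binary using (IsEquivalence; Setoid)
import Relation.Binary.Reasoning.Setoid as SetoidReasoning

private
  variable
    o ℓ e o′ ℓ′ e′ ε m : Level

record Category (o ℓ e : Level) : Set (suc (o ⊔ ℓ ⊔ e)) where
  infix  4 _⇒_ _≈_
  infixr 9 _∘_
  field
    Obj       : Set o
    _⇒_       : Obj → Obj → Set ℓ
    _≈_       : ∀ {A B} → A ⇒ B → A ⇒ B → Set e
    id        : ∀ {A} → A ⇒ A
    _∘_       : ∀ {A B C} → B ⇒ C → A ⇒ B → A ⇒ C
    equiv     : ∀ {A B} → IsEquivalence (_≈_ {A} {B})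
    ∘-resp-≈  : ∀ {A B C} {f h : B ⇒ C} {g i : A ⇒ B} →
                f ≈ h → g ≈ i → f ∘ g ≈ h ∘ i
    identityˡ : ∀ {A B} {f : A ⇒ B} → id ∘ f ≈ f
    identityʳ : ∀ {A B} {f : A ⇒ B} → f ∘ id ≈ f
    assoc     : ∀ {A B C D} {f : A ⇒ B} {g : B ⇒ C} {h : C ⇒ D} →
                (h ∘ g) ∘ f ≈ h ∘ (g ∘ f)

  module Equiv {A B : Obj} = IsEquivalence (equiv {A} {B})

  hom-setoid : ∀ {A B} → Setoid ℓ e
  hom-setoid {A} {B} = record
    { Carrier = A ⇒ B ; _≈_ = _≈_ ; isEquivalence = equiv }

  record IsIso {A B} (f : A ⇒ B) : Set (ℓ ⊔ e) where
    field
      inv  : B ⇒ A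
      isoˡ : inv ∘ f ≈ id
      isoʳ : f ∘ inv ≈ id

  module HomReasoning {A B : Obj} where
    open SetoidReasoning (hom-setoid {A} {B}) public

  infixr 4 _⟩∘⟨_ refl⟩∘⟨_
  infixl 5 _⟩∘⟨refl

  _⟩∘⟨_ : ∀ {A B C} {f h : B ⇒ C} {g i : A ⇒ B} →
          f ≈ h → g ≈ i → f ∘ g ≈ h ∘ i
  _⟩∘⟨_ = ∘-resp-≈

  refl⟩∘⟨_ : ∀ {A B C} {f : B ⇒ C} {g i : A ⇒ B} → g ≈ i → f ∘ g ≈ f ∘ i
  refl⟩∘⟨_ = ∘-resp-≈ Equiv.refl

  _⟩∘⟨refl : ∀ {A B C} {f h : B ⇒ C} {g : A ⇒ B} → f ≈ h → f ∘ g ≈ h ∘ g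
  _⟩∘⟨refl p = ∘-resp-≈ p Equiv.refl

  module _ {A B C D : Obj} {f : C ⇒ D} {g : B ⇒ C} where

    pullˡ : ∀ {h : B ⇒ D} {k : A ⇒ B} → f ∘ g ≈ h → f ∘ (g ∘ k) ≈ h ∘ k
    pullˡ p = Equiv.trans (Equiv.sym assoc) (p ⟩∘⟨refl)

    pushˡ : ∀ {h : B ⇒ D} {k : A ⇒ B} → h ≈ f ∘ g → h ∘ k ≈ f ∘ (g ∘ k)
    pushˡ p = Equiv.trans (p ⟩∘⟨refl) assoc

    extendʳ : ∀ {X} {h : X ⇒ D} {i : B ⇒ X} {k : A ⇒ B} →
              f ∘ g ≈ h ∘ i → f ∘ (g ∘ k) ≈ h ∘ (i ∘ k)
    extendʳ p = Equiv.trans (pullˡ p) assoc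

record Functor (C : Category o ℓ e) (D : Category o′ ℓ′ e′)
               : Set (o ⊔ ℓ ⊔ e ⊔ o′ ⊔ ℓ′ ⊔ e′) where
  private
    module C = Category C
    module D = Category D
  field
    F₀           : C.Obj → D.Obj
    F₁           : ∀ {A B} → A C.⇒ B → F₀ A D.⇒ F₀ B
    F-resp-≈     : ∀ {A B} {f g : A C.⇒ B} → f C.≈ g → F₁ f D.≈ F₁ g
    identity     : ∀ {A} → F₁ (C.id {A}) D.≈ D.id
    homomorphism : ∀ {X Y Z} {f : X C.⇒ Y} {g : Y C.⇒ Z} →
                   F₁ (g C.∘ f) D.≈ F₁ g D.∘ F₁ f

-- The directions of λ⇒, ρ⇒ and α⇒ are those of left-skew monoidal categories;
-- they need not be invertible.

record SkewMonoidal (C : Category o ℓ e) : Set (o ⊔ ℓ ⊔ e) where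
  open Category C
  infixr 10 _⊗₀_ _⊗₁_
  infixl 11 _▷_
  infixr 11 _◁_
  field
    unit       : Obj
    _⊗₀_       : Obj → Obj → Obj
    _⊗₁_       : ∀ {A B A′ B′} → A ⇒ B → A′ ⇒ B′ → A ⊗₀ A′ ⇒ B ⊗₀ B′
    ⊗-resp-≈   : ∀ {A B A′ B′} {f g : A ⇒ B} {f′ g′ : A′ ⇒ B′} →
                 f ≈ g → f′ ≈ g′ → f ⊗₁ f′ ≈ g ⊗₁ g′
    ⊗-identity : ∀ {A B} → id {A} ⊗₁ id {B} ≈ id
    ⊗-∘        : ∀ {A B C A′ B′ C′}
                 {f : A ⇒ B} {g : B ⇒ C} {f′ : A′ ⇒ B′} {g′ : B′ ⇒ C′} →
                 (g ∘ f) ⊗₁ (g′ ∘ f′) ≈ (g ⊗₁ g′) ∘ (f ⊗₁ f′)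

    λ⇒ : ∀ X → unit ⊗₀ X ⇒ X
    ρ⇒ : ∀ X → X ⇒ X ⊗₀ unit
    α⇒ : ∀ X Y Z → (X ⊗₀ Y) ⊗₀ Z ⇒ X ⊗₀ (Y ⊗₀ Z)

    λ-natural : ∀ {X Y} {f : X ⇒ Y} → λ⇒ Y ∘ (id ⊗₁ f) ≈ f ∘ λ⇒ X
    ρ-natural : ∀ {X Y} {f : X ⇒ Y} → ρ⇒ Y ∘ f ≈ (f ⊗₁ id) ∘ ρ⇒ X
    α-natural : ∀ {X Y Z X′ Y′ Z′} {f : X ⇒ X′} {g : Y ⇒ Y′} {h : Z ⇒ Z′} →
                α⇒ X′ Y′ Z′ ∘ ((f ⊗₁ g) ⊗₁ h) ≈ (f ⊗₁ (g ⊗₁ h)) ∘ α⇒ X Y Z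

    λρ       : λ⇒ unit ∘ ρ⇒ unit ≈ id
    λα       : ∀ {X Y} → λ⇒ (X ⊗₀ Y) ∘ α⇒ unit X Y ≈ λ⇒ X ⊗₁ id
    αρ       : ∀ {X Y} → α⇒ X Y unit ∘ ρ⇒ (X ⊗₀ Y) ≈ id ⊗₁ ρ⇒ Y
    triangle : ∀ {X Y} → (id ⊗₁ λ⇒ Y) ∘ α⇒ X unit Y ∘ (ρ⇒ X ⊗₁ id) ≈ id
    pentagon : ∀ {W X Y Z} →
               (id ⊗₁ α⇒ X Y Z) ∘ α⇒ W (X ⊗₀ Y) Z ∘ (α⇒ W X Y ⊗₁ id)
               ≈ α⇒ W X (Y ⊗₀ Z) ∘ α⇒ (W ⊗₀ X) Y Z

  _▷_ : ∀ {A B} → A ⇒ B → ∀ X → A ⊗₀ X ⇒ B ⊗₀ X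
  f ▷ X = f ⊗₁ id {X}

  _◁_ : ∀ X {A B} → A ⇒ B → X ⊗₀ A ⇒ X ⊗₀ B
  X ◁ f = id {X} ⊗₁ f

record IsMonoidal {C : Category o ℓ e} (S : SkewMonoidal C) : Set (o ⊔ ℓ ⊔ e) where
  open Category C
  open SkewMonoidal S
  field
    λ-iso : ∀ X → IsIso (λ⇒ X)
    ρ-iso : ∀ X → IsIso (ρ⇒ X)
    α-iso : ∀ X Y Z → IsIso (α⇒ X Y Z)

-- Mac Lane's five coherence axioms are all included; under invertibility
-- three of them follow from the triangle and the pentagon.

record Monoidal (C : Category o ℓ e) : Set (o ⊔ ℓ ⊔ e) where
  field
    skew       : SkewMonoidal C
    isMonoidal : IsMonoidal skew
  open SkewMonoidal skew public
  open IsMonoidal isMonoidal public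

record LaxMonoidalFunctor {G : Category o ℓ e} {C : Category o′ ℓ′ e′}
                          (V : SkewMonoidal G) (W : SkewMonoidal C)
                          : Set (o ⊔ ℓ ⊔ e ⊔ o′ ⊔ ℓ′ ⊔ e′) where
  private
    module G = Category G
    module V = SkewMonoidal V
    module W = SkewMonoidal W
  open Category C
  field
    functor : Functor G C
  open Functor functor public
  field
    η         : W.unit ⇒ F₀ V.unit
    μ         : ∀ X Y → F₀ X W.⊗₀ F₀ Y ⇒ F₀ (X V.⊗₀ Y)
    μ-natural : ∀ {X Y X′ Y′} {f : X G.⇒ X′} {g : Y G.⇒ Y′} →
                μ X′ Y′ ∘ (F₁ f W.⊗₁ F₁ g) ≈ F₁ (f V.⊗₁ g) ∘ μ X Y
    unitˡ     : ∀ {X} → F₁ (V.λ⇒ X) ∘ μ V.unit X ∘ (η W.▷ F₀ X) ≈ W.λ⇒ (F₀ X)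
    unitʳ     : ∀ {X} → F₁ (V.ρ⇒ X) ≈ μ X V.unit ∘ (F₀ X W.◁ η) ∘ W.ρ⇒ (F₀ X)
    assoc-μ   : ∀ {X Y Z} →
                F₁ (V.α⇒ X Y Z) ∘ μ (X V.⊗₀ Y) Z ∘ (μ X Y W.▷ F₀ Z)
                ≈ μ X (Y V.⊗₀ Z) ∘ (F₀ X W.◁ μ Y Z) ∘ W.α⇒ (F₀ X) (F₀ Y) (F₀ Z)

record Monoid {C : Category o ℓ e} (V : Monoidal C) : Set (o ⊔ ℓ ⊔ e) where
  open Category C
  open Monoidal V
  field
    T      : Obj
    η      : unit ⇒ T
    μ      : T ⊗₀ T ⇒ T
    unitˡ  : μ ∘ (η ▷ T) ≈ λ⇒ T
    unitʳ  : μ ∘ (T ◁ η) ∘ ρ⇒ T ≈ id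
    μ-assoc : μ ∘ (μ ▷ T) ≈ μ ∘ (T ◁ μ) ∘ α⇒ T T T

record FiniteProducts (C : Category o ℓ e) : Set (o ⊔ ℓ ⊔ e) where
  open Category C
  field
    ∏       : ∀ {n} → (Fin n → Obj) → Obj
    π       : ∀ {n} {X : Fin n → Obj} (i : Fin n) → ∏ X ⇒ X i
    ⟨_⟩     : ∀ {n Y} {X : Fin n → Obj} → (∀ i → Y ⇒ X i) → Y ⇒ ∏ X
    project : ∀ {n Y} {X : Fin n → Obj} {f : ∀ i → Y ⇒ X i} i →
              π i ∘ ⟨ f ⟩ ≈ f i
    unique  : ∀ {n Y} {X : Fin n → Obj} {f : ∀ i → Y ⇒ X i} {h : Y ⇒ ∏ X} →
              (∀ i → π i ∘ h ≈ f i) → ⟨ f ⟩ ≈ h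

  ∏₁ : ∀ {n} {X Y : Fin n → Obj} → (∀ i → X i ⇒ Y i) → ∏ X ⇒ ∏ Y
  ∏₁ f = ⟨ (λ i → f i ∘ π i) ⟩

  _^_ : Obj → ℕ → Obj
  X ^ n = ∏ {n} (λ _ → X)

  ⟨⟩-cong : ∀ {n Y} {X : Fin n → Obj} {f g : ∀ i → Y ⇒ X i} →
            (∀ i → f i ≈ g i) → ⟨ f ⟩ ≈ ⟨ g ⟩
  ⟨⟩-cong p = unique λ i → Equiv.trans (project i) (Equiv.sym (p i))

  ⟨⟩-∘ : ∀ {n Y Z} {X : Fin n → Obj} {f : ∀ i → Y ⇒ X i} {h : Z ⇒ Y} →
         ⟨ f ⟩ ∘ h ≈ ⟨ (λ i → f i ∘ h) ⟩
  ⟨⟩-∘ = Equiv.sym (unique λ i → pullˡ (project i))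

  ∏₁-⟨⟩ : ∀ {n Z} {X Y : Fin n → Obj} {f : ∀ i → X i ⇒ Y i} {g : ∀ i → Z ⇒ X i} →
          ∏₁ f ∘ ⟨ g ⟩ ≈ ⟨ (λ i → f i ∘ g i) ⟩
  ∏₁-⟨⟩ = Equiv.trans ⟨⟩-∘
    (⟨⟩-cong λ i → Equiv.trans assoc (refl⟩∘⟨ project i))

record EMFactorization (C : Category o ℓ e)
                       (E : ∀ {A B} → Category._⇒_ C A B → Set ε)
                       (M : ∀ {A B} → Category._⇒_ C A B → Set m)
                       {A B} (f : Category._⇒_ C A B)
                       : Set (o ⊔ ℓ ⊔ e ⊔ ε ⊔ m) where
  open Category C
  field
    {mid}   : Obj
    left    : A ⇒ mid
    right   : mid ⇒ B
    left∈E  : E left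
    right∈M : M right
    factors : f ≈ right ∘ left

-- Since homs are setoids, E and M are required to be invariant under ≈.

record OrthogonalFactorizationSystem (C : Category o ℓ e) (ε m : Level)
                                     : Set (o ⊔ ℓ ⊔ e ⊔ suc (ε ⊔ m)) where
  open Category C
  field
    E : ∀ {A B} → A ⇒ B → Set ε
    M : ∀ {A B} → A ⇒ B → Set m
    E-resp-≈ : ∀ {A B} {f g : A ⇒ B} → f ≈ g → E f → E g
    M-resp-≈ : ∀ {A B} {f g : A ⇒ B} → f ≈ g → M f → M g
    E-iso : ∀ {A B} {f : A ⇒ B} → IsIso f → E f
    M-iso : ∀ {A B} {f : A ⇒ B} → IsIso f → M f
    E-∘   : ∀ {A B C} {g : B ⇒ C} {f : A ⇒ B} → E g → E f → E (g ∘ f)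
    M-∘   : ∀ {A B C} {g : B ⇒ C} {f : A ⇒ B} → M g → M f → M (g ∘ f)
    diagonal : ∀ {A B X Y} {p : A ⇒ B} {i : X ⇒ Y} {f : A ⇒ X} {g : B ⇒ Y} →
               E p → M i → g ∘ p ≈ i ∘ f →
               ∃! _≈_ λ (d : B ⇒ X) → d ∘ p ≈ f × i ∘ d ≈ g

    factorize : ∀ {A B} (f : A ⇒ B) → EMFactorization C E M f

  Factorization : ∀ {A B} → A ⇒ B → Set (o ⊔ ℓ ⊔ e ⊔ ε ⊔ m)
  Factorization = EMFactorization C E M

module _ {C : Category o ℓ e} (F : OrthogonalFactorizationSystem C ε m)
         (P : FiniteProducts C) where
  open Category C
  open FiniteProducts P
  open OrthogonalFactorizationSystem F

  ProductClosed : Set (o ⊔ ℓ ⊔ ε)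
  ProductClosed = ∀ {n} {X Y : Fin n → Obj} {f : ∀ i → X i ⇒ Y i} →
                  (∀ i → E (f i)) → E (∏₁ f)

  ContainsCanonical : Monoidal C → Set (o ⊔ ε)
  ContainsCanonical V = ∀ {n} (X : Fin n → Obj) (Y : Obj) →
                        E ⟨ (λ i → π {X = X} i ▷ Y) ⟩
    where open Monoidal V

module _ {C : Category o ℓ e} {V : Monoidal C} (P : FiniteProducts C) where
  open Category C
  open Monoidal V
  open FiniteProducts P

  IsAlgebraic : (𝖳 : Monoid V) → ∀ {n} → Monoid.T 𝖳 ^ n ⇒ Monoid.T 𝖳 → Set e
  IsAlgebraic 𝖳 φ =
    φ ∘ ∏₁ (λ _ → μ) ∘ ⟨ (λ i → π i ▷ T) ⟩ ≈ μ ∘ (φ ▷ T)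
    where open Monoid 𝖳

module _ {C : Category o ℓ e} (P : FiniteProducts C) (V : Monoidal C)
         {G : Category o′ ℓ′ e′} (U : Monoidal G)
         (L : LaxMonoidalFunctor (Monoidal.skew U) (Monoidal.skew V)) where
  open Category C
  open Monoidal V
  open FiniteProducts P
  private
    module G = Category G
    module U = Monoidal U
  open LaxMonoidalFunctor L using (F₀; F₁) renaming (μ to μᴳ)

  OperationFamily : ∀ {n} → (Fin n → G.Obj) → G.Obj → Set (ℓ ⊔ o′)
  OperationFamily d d′ = ∀ x → ∏ (λ i → F₀ (d i U.⊗₀ x)) ⇒ F₀ (d′ U.⊗₀ x)

  record IsGradedAlgebraic {n} (d : Fin n → G.Obj) (d′ : G.Obj)
                           (ψ : OperationFamily d d′)
                           : Set (e ⊔ o′ ⊔ ℓ′) where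
    field
      natural   : ∀ {x y} (h : x G.⇒ y) →
                  ψ y ∘ ∏₁ (λ i → F₁ (d i U.◁ h)) ≈ F₁ (d′ U.◁ h) ∘ ψ x
      algebraic : ∀ x y →
                  ψ (x U.⊗₀ y)
                    ∘ ∏₁ (λ i → F₁ (U.α⇒ (d i) x y))
                    ∘ ∏₁ (λ i → μᴳ (d i U.⊗₀ x) y)
                    ∘ ⟨ (λ i → π i ▷ F₀ y) ⟩
                  ≈ F₁ (U.α⇒ d′ x y) ∘ μᴳ (d′ U.⊗₀ x) y ∘ (ψ x ▷ F₀ y)

-- The comparison maps of a grading form a monoidal transformation to 𝖳.

record Grading {C : Category o ℓ e} {V : Monoidal C} (𝖳 : Monoid V)
               (F : OrthogonalFactorizationSystem C ε m)
               {G : Category o′ ℓ′ e′} (U : Monoidal G)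
               : Set (o ⊔ ℓ ⊔ e ⊔ m ⊔ o′ ⊔ ℓ′ ⊔ e′) where
  private
    module G = Category G
    module U = Monoidal U
    module 𝖳 = Monoid 𝖳
  open Category C
  open Monoidal V
  open OrthogonalFactorizationSystem F
  field
    lax : LaxMonoidalFunctor (Monoidal.skew U) (Monoidal.skew V)
  open LaxMonoidalFunctor lax
  field
    g         : ∀ d → F₀ d ⇒ 𝖳.T
    g∈M       : ∀ d → M (g d)
    g-natural : ∀ {d d′} (h : d G.⇒ d′) → g d′ ∘ F₁ h ≈ g d
    g-unit    : g U.unit ∘ η ≈ 𝖳.η
    g-mult    : ∀ d d′ → g (d U.⊗₀ d′) ∘ μ d d′ ≈ 𝖳.μ ∘ (g d ⊗₁ g d′)

module _ {C : Category o ℓ e} {V : Monoidal C} (P : FiniteProducts C)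
         {𝖳 : Monoid V} {F : OrthogonalFactorizationSystem C ε m}
         {G : Category o′ ℓ′ e′} {U : Monoidal G}
         (γ : Grading 𝖳 F U) where
  open Category C
  open FiniteProducts P
  open Monoid 𝖳
  open Grading γ
  private module U = Monoidal U

  Grades : ∀ {n} (d : Fin n → Category.Obj G) (d′ : Category.Obj G) →
           OperationFamily P V U lax d d′ → T ^ n ⇒ T → Set (e ⊔ o′)
  Grades d d′ ψ φ =
    ∀ x → g (d′ U.⊗₀ x) ∘ ψ x ≈ φ ∘ ∏₁ (λ i → g (d i U.⊗₀ x))

module _ {C : Category o ℓ e} {V : Monoidal C} (𝖳 : Monoid V)
         (F : OrthogonalFactorizationSystem C ε m) where
  open Category C
  open Monoidal V
  open Monoid 𝖳
  open OrthogonalFactorizationSystem F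

  record SliceObj : Set (o ⊔ ℓ ⊔ m) where
    constructor sliceObj
    field
      {obj} : Obj
      arr   : obj ⇒ T
      arr∈M : M arr
  open SliceObj

  record SliceHom (S S′ : SliceObj) : Set (ℓ ⊔ e) where
    constructor sliceHom
    field
      mor : obj S ⇒ obj S′
      tri : arr S′ ∘ mor ≈ arr S
  open SliceHom

  Slice : Category (o ⊔ ℓ ⊔ m) (ℓ ⊔ e) e
  Slice = record
    { Obj = SliceObj
    ; _⇒_ = SliceHom
    ; _≈_ = λ f g → mor f ≈ mor g
    ; id  = sliceHom id identityʳ
    ; _∘_ = λ g f → sliceHom (mor g ∘ mor f)
                             (Equiv.trans (pullˡ (tri g)) (tri f))
    ; equiv = record { refl = Equiv.refl ; sym = Equiv.sym ; trans = Equiv.trans }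
    ; ∘-resp-≈  = ∘-resp-≈
    ; identityˡ = identityˡ
    ; identityʳ = identityʳ
    ; assoc     = assoc
    }

  TensorClosed : Set (o ⊔ ℓ ⊔ ε ⊔ m)
  TensorClosed = ∀ (S : SliceObj) {A B} {f : A ⇒ B} → E f → E (f ▷ obj S)

  UnitFactorization : Set (o ⊔ ℓ ⊔ e ⊔ ε ⊔ m)
  UnitFactorization = Factorization η

  TensorFactorizations : Set (o ⊔ ℓ ⊔ e ⊔ ε ⊔ m)
  TensorFactorizations = ∀ S S′ → Factorization (μ ∘ (arr S ⊗₁ arr S′))

open SliceObj public
open SliceHom public

-- The factorizations defining J and ⊠ are arbitrary: they are not required to
-- be the ones returned by 'factorize'.

module SliceMonoidal
  {C : Category o ℓ e} {V : Monoidal C} {𝖳 : Monoid V}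
  {F : OrthogonalFactorizationSystem C ε m}
  (η-factor : UnitFactorization 𝖳 F)
  (⊗-factor : TensorFactorizations 𝖳 F)
  (⊗-closed : TensorClosed 𝖳 F)
  where

  open Category C
  open HomReasoning
  open Monoidal V
  open Monoid 𝖳
  open OrthogonalFactorizationSystem F
  open EMFactorization

  infixr 10 _⊠₀_ _⊠₁_

  private
    Sl : Set _
    Sl = SliceObj 𝖳 F
    infix 4 _⇒/_
    _⇒/_ : Sl → Sl → Set _
    _⇒/_ = SliceHom 𝖳 F

  J : SliceObj 𝖳 F
  J = sliceObj (right η-factor) (right∈M η-factor)

  qJ : unit ⇒ obj J
  qJ = left η-factor

  _⊠₀_ : SliceObj 𝖳 F → SliceObj 𝖳 F → SliceObj 𝖳 F
  S ⊠₀ S′ = sliceObj (right (⊗-factor S S′)) (right∈M (⊗-factor S S′))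

  q : ∀ S S′ → obj S ⊗₀ obj S′ ⇒ obj (S ⊠₀ S′)
  q S S′ = left (⊗-factor S S′)

  qJ∈E : E qJ
  qJ∈E = left∈E η-factor

  q∈E : ∀ {S S′} → E (q S S′)
  q∈E = left∈E (⊗-factor _ _)

  arr-qJ : arr J ∘ qJ ≈ η
  arr-qJ = Equiv.sym (factors η-factor)

  arr-q : ∀ {S S′} → arr (S ⊠₀ S′) ∘ q S S′ ≈ μ ∘ (arr S ⊗₁ arr S′)
  arr-q = Equiv.sym (factors (⊗-factor _ _))

  module _ {S S′ : SliceObj 𝖳 F} {A} {p : A ⇒ obj S} (p∈E : E p) where

    lift : (f : A ⇒ obj S′) → arr S ∘ p ≈ arr S′ ∘ f → SliceHom 𝖳 F S S′
    lift f sq = let d , (_ , t) , _ = diagonal p∈E (arr∈M S′) sq in sliceHom d t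

    lift-β : {f : A ⇒ obj S′} {sq : arr S ∘ p ≈ arr S′ ∘ f} → mor (lift f sq) ∘ p ≈ f
    lift-β {sq = sq} = let _ , (b , _) , _ = diagonal p∈E (arr∈M S′) sq in b

    cancel : (f g : SliceHom 𝖳 F S S′) → mor f ∘ p ≈ mor g ∘ p → mor f ≈ mor g
    cancel f g eq =
      let _ , _ , u = diagonal p∈E (arr∈M S′)
                        (Equiv.trans (Equiv.sym (tri f) ⟩∘⟨refl) assoc)
      in Equiv.trans (Equiv.sym (u (Equiv.refl , tri f))) (u (Equiv.sym eq , tri g))

  private
    ▷-∘ : ∀ {X A B D} {g : B ⇒ D} {f : A ⇒ B} → (g ∘ f) ▷ X ≈ (g ▷ X) ∘ (f ▷ X)
    ▷-∘ = Equiv.trans (⊗-resp-≈ Equiv.refl (Equiv.sym identityˡ)) ⊗-∘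

    ◁-∘ : ∀ {X A B D} {g : B ⇒ D} {f : A ⇒ B} → X ◁ (g ∘ f) ≈ (X ◁ g) ∘ (X ◁ f)
    ◁-∘ = Equiv.trans (⊗-resp-≈ (Equiv.sym identityˡ) Equiv.refl) ⊗-∘

    ▷-resp : ∀ {X A B} {f g : A ⇒ B} → f ≈ g → f ▷ X ≈ g ▷ X
    ▷-resp eq = ⊗-resp-≈ eq Equiv.refl

    ◁-resp : ∀ {X A B} {f g : A ⇒ B} → f ≈ g → X ◁ f ≈ X ◁ g
    ◁-resp eq = ⊗-resp-≈ Equiv.refl eq

    ⊗-▷ : ∀ {A B D A′ B′} {f : A ⇒ B} {g : B ⇒ D} {h : A′ ⇒ B′} →
          (g ⊗₁ h) ∘ (f ▷ A′) ≈ (g ∘ f) ⊗₁ h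
    ⊗-▷ = Equiv.trans (Equiv.sym ⊗-∘) (⊗-resp-≈ Equiv.refl identityʳ)

    ⊗-◁ : ∀ {A B A′ B′ D′} {h : A ⇒ B} {f : A′ ⇒ B′} {g : B′ ⇒ D′} →
          (h ⊗₁ g) ∘ (A ◁ f) ≈ h ⊗₁ (g ∘ f)
    ⊗-◁ = Equiv.trans (Equiv.sym ⊗-∘) (⊗-resp-≈ identityʳ Equiv.refl)

    ▷-⊗ : ∀ {A B D A′ B′} {f : A ⇒ B} {g : B ⇒ D} {h : A′ ⇒ B′} →
          (g ▷ B′) ∘ (f ⊗₁ h) ≈ (g ∘ f) ⊗₁ h
    ▷-⊗ = Equiv.trans (Equiv.sym ⊗-∘) (⊗-resp-≈ Equiv.refl identityˡ)

    ◁-⊗ : ∀ {A B A′ B′ D′} {h : A ⇒ B} {f : A′ ⇒ B′} {g : B′ ⇒ D′} →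
          (B ◁ g) ∘ (h ⊗₁ f) ≈ h ⊗₁ (g ∘ f)
    ◁-⊗ = Equiv.trans (Equiv.sym ⊗-∘) (⊗-resp-≈ identityˡ Equiv.refl)

    slide : ∀ {A B A′ B′} {f : A ⇒ B} {g : A′ ⇒ B′} →
            (f ▷ B′) ∘ (A ◁ g) ≈ (B ◁ g) ∘ (f ▷ A′)
    slide = Equiv.trans ⊗-◁ (Equiv.trans (⊗-resp-≈ Equiv.refl identityˡ)
              (Equiv.sym (Equiv.trans ⊗-▷ (⊗-resp-≈ identityˡ Equiv.refl))))

    α-▷ : ∀ {A B X Y} {f : A ⇒ B} → α⇒ B X Y ∘ (f ▷ X ▷ Y) ≈ (f ▷ (X ⊗₀ Y)) ∘ α⇒ A X Y
    α-▷ = Equiv.trans α-natural (⊗-resp-≈ Equiv.refl ⊗-identity ⟩∘⟨refl)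

    α-◁ : ∀ {A B X Y} {f : A ⇒ B} → α⇒ X Y B ∘ ((X ⊗₀ Y) ◁ f) ≈ (X ◁ Y ◁ f) ∘ α⇒ X Y A
    α-◁ = Equiv.trans (refl⟩∘⟨ ⊗-resp-≈ (Equiv.sym ⊗-identity) Equiv.refl) α-natural

  infixr 9 _∘/_
  private
    _∘/_ : ∀ {S S′ S″} → S′ ⇒/ S″ → S ⇒/ S′ → S ⇒/ S″
    _∘/_ = Category._∘_ (Slice 𝖳 F)
    id/ : ∀ {S} → S ⇒/ S
    id/ = Category.id (Slice 𝖳 F)

  _⊠₁_ : ∀ {S₁ S₂ S₁′ S₂′} → SliceHom 𝖳 F S₁ S₂ → SliceHom 𝖳 F S₁′ S₂′ →
         SliceHom 𝖳 F (S₁ ⊠₀ S₁′) (S₂ ⊠₀ S₂′)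
  _⊠₁_ {S₁} {S₂} {S₁′} {S₂′} f f′ = lift q∈E (q S₂ S₂′ ∘ (mor f ⊗₁ mor f′)) (begin
    arr (S₁ ⊠₀ S₁′) ∘ q S₁ S₁′                      ≈⟨ arr-q ⟩
    μ ∘ (arr S₁ ⊗₁ arr S₁′)                         ≈⟨ refl⟩∘⟨ ⊗-resp-≈ (tri f) (tri f′) ⟨
    μ ∘ ((arr S₂ ∘ mor f) ⊗₁ (arr S₂′ ∘ mor f′))    ≈⟨ refl⟩∘⟨ ⊗-∘ ⟩
    μ ∘ (arr S₂ ⊗₁ arr S₂′) ∘ (mor f ⊗₁ mor f′)     ≈⟨ extendʳ arr-q ⟨
    arr (S₂ ⊠₀ S₂′) ∘ q S₂ S₂′ ∘ (mor f ⊗₁ mor f′)  ∎)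

  ⊠-β : ∀ {S₁ S₂ S₁′ S₂′} {f : SliceHom 𝖳 F S₁ S₂} {f′ : SliceHom 𝖳 F S₁′ S₂′} →
        mor (f ⊠₁ f′) ∘ q S₁ S₁′ ≈ q S₂ S₂′ ∘ (mor f ⊗₁ mor f′)
  ⊠-β {S₁} {S₂} {S₁′} {S₂′} = lift-β {S₁ ⊠₀ S₁′} {S₂ ⊠₀ S₂′} q∈E

  qλ∈E : ∀ {S} → E (q J S ∘ (qJ ▷ obj S))
  qλ∈E {S} = E-∘ q∈E (⊗-closed S qJ∈E)

  qα∈E : ∀ {S S′ S″} → E (q (S ⊠₀ S′) S″ ∘ (q S S′ ▷ obj S″))
  qα∈E {S″ = S″} = E-∘ q∈E (⊗-closed S″ q∈E)

  l : ∀ S → SliceHom 𝖳 F (J ⊠₀ S) S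
  l S = lift qλ∈E (λ⇒ (obj S)) (begin
    arr (J ⊠₀ S) ∘ q J S ∘ (qJ ▷ obj S)  ≈⟨ extendʳ arr-q ⟩
    μ ∘ (arr J ⊗₁ arr S) ∘ (qJ ▷ obj S)  ≈⟨ refl⟩∘⟨ ⊗-▷ ⟩
    μ ∘ ((arr J ∘ qJ) ⊗₁ arr S)          ≈⟨ refl⟩∘⟨ ⊗-resp-≈ (Equiv.trans arr-qJ (Equiv.sym identityʳ)) Equiv.refl ⟩
    μ ∘ ((η ∘ id) ⊗₁ arr S)              ≈⟨ refl⟩∘⟨ ▷-⊗ ⟨
    μ ∘ (η ▷ T) ∘ (unit ◁ arr S)         ≈⟨ pullˡ unitˡ ⟩
    λ⇒ T ∘ (unit ◁ arr S)                ≈⟨ λ-natural ⟩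
    arr S ∘ λ⇒ (obj S)                   ∎)

  l-β : ∀ {S} → mor (l S) ∘ q J S ∘ (qJ ▷ obj S) ≈ λ⇒ (obj S)
  l-β {S} = lift-β {J ⊠₀ S} {S} qλ∈E

  r : ∀ S → SliceHom 𝖳 F S (S ⊠₀ J)
  r S = sliceHom (q S J ∘ (obj S ◁ qJ) ∘ ρ⇒ (obj S)) (begin
    arr (S ⊠₀ J) ∘ q S J ∘ (obj S ◁ qJ) ∘ ρ⇒ (obj S)  ≈⟨ extendʳ arr-q ⟩
    μ ∘ (arr S ⊗₁ arr J) ∘ (obj S ◁ qJ) ∘ ρ⇒ (obj S)  ≈⟨ refl⟩∘⟨ pullˡ ⊗-◁ ⟩
    μ ∘ (arr S ⊗₁ (arr J ∘ qJ)) ∘ ρ⇒ (obj S)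
      ≈⟨ refl⟩∘⟨ ⊗-resp-≈ Equiv.refl (Equiv.trans arr-qJ (Equiv.sym identityʳ)) ⟩∘⟨refl ⟩
    μ ∘ (arr S ⊗₁ (η ∘ id)) ∘ ρ⇒ (obj S)              ≈⟨ refl⟩∘⟨ pullˡ ◁-⊗ ⟨
    μ ∘ (T ◁ η) ∘ (arr S ▷ unit) ∘ ρ⇒ (obj S)         ≈⟨ refl⟩∘⟨ refl⟩∘⟨ ρ-natural ⟨
    μ ∘ (T ◁ η) ∘ ρ⇒ T ∘ arr S                        ≈⟨ refl⟩∘⟨ assoc ⟨
    μ ∘ ((T ◁ η) ∘ ρ⇒ T) ∘ arr S                      ≈⟨ pullˡ unitʳ ⟩
    id ∘ arr S                                        ≈⟨ identityˡ ⟩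
    arr S                                             ∎)

  a : ∀ S S′ S″ → SliceHom 𝖳 F ((S ⊠₀ S′) ⊠₀ S″) (S ⊠₀ (S′ ⊠₀ S″))
  a S S′ S″ = lift qα∈E
    (q S (S′ ⊠₀ S″) ∘ (obj S ◁ q S′ S″) ∘ α⇒ (obj S) (obj S′) (obj S″)) (begin
    arr ((S ⊠₀ S′) ⊠₀ S″) ∘ q (S ⊠₀ S′) S″ ∘ (q S S′ ▷ obj S″)  ≈⟨ extendʳ arr-q ⟩
    μ ∘ (arr (S ⊠₀ S′) ⊗₁ arr S″) ∘ (q S S′ ▷ obj S″)           ≈⟨ refl⟩∘⟨ ⊗-▷ ⟩
    μ ∘ ((arr (S ⊠₀ S′) ∘ q S S′) ⊗₁ arr S″)                    ≈⟨ refl⟩∘⟨ ⊗-resp-≈ arr-q Equiv.refl ⟩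
    μ ∘ ((μ ∘ (arr S ⊗₁ arr S′)) ⊗₁ arr S″)                     ≈⟨ refl⟩∘⟨ ▷-⊗ ⟨
    μ ∘ (μ ▷ T) ∘ ((arr S ⊗₁ arr S′) ⊗₁ arr S″)                 ≈⟨ extendʳ μ-assoc ⟩
    μ ∘ ((T ◁ μ) ∘ α⇒ T T T) ∘ ((arr S ⊗₁ arr S′) ⊗₁ arr S″)    ≈⟨ refl⟩∘⟨ assoc ⟩
    μ ∘ (T ◁ μ) ∘ α⇒ T T T ∘ ((arr S ⊗₁ arr S′) ⊗₁ arr S″)      ≈⟨ refl⟩∘⟨ refl⟩∘⟨ α-natural ⟩
    μ ∘ (T ◁ μ) ∘ (arr S ⊗₁ (arr S′ ⊗₁ arr S″)) ∘ α⇒ _ _ _      ≈⟨ refl⟩∘⟨ pullˡ ◁-⊗ ⟩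
    μ ∘ (arr S ⊗₁ (μ ∘ (arr S′ ⊗₁ arr S″))) ∘ α⇒ _ _ _
      ≈⟨ refl⟩∘⟨ ⊗-resp-≈ Equiv.refl arr-q ⟩∘⟨refl ⟨
    μ ∘ (arr S ⊗₁ (arr (S′ ⊠₀ S″) ∘ q S′ S″)) ∘ α⇒ _ _ _        ≈⟨ refl⟩∘⟨ pullˡ ⊗-◁ ⟨
    μ ∘ (arr S ⊗₁ arr (S′ ⊠₀ S″)) ∘ (obj S ◁ q S′ S″) ∘ α⇒ _ _ _ ≈⟨ extendʳ arr-q ⟨
    arr (S ⊠₀ (S′ ⊠₀ S″)) ∘ q S (S′ ⊠₀ S″) ∘ (obj S ◁ q S′ S″) ∘ α⇒ _ _ _ ∎)

  a-β : ∀ {S S′ S″} →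
        mor (a S S′ S″) ∘ q (S ⊠₀ S′) S″ ∘ (q S S′ ▷ obj S″)
        ≈ q S (S′ ⊠₀ S″) ∘ (obj S ◁ q S′ S″) ∘ α⇒ (obj S) (obj S′) (obj S″)
  a-β {S} {S′} {S″} = lift-β {(S ⊠₀ S′) ⊠₀ S″} {S ⊠₀ (S′ ⊠₀ S″)} qα∈E

  private
    a-β′ : ∀ {S S′ S″ A} {k : A ⇒ _} →
           mor (a S S′ S″) ∘ q (S ⊠₀ S′) S″ ∘ (q S S′ ▷ obj S″) ∘ k
           ≈ q S (S′ ⊠₀ S″) ∘ (obj S ◁ q S′ S″) ∘ α⇒ (obj S) (obj S′) (obj S″) ∘ k
    a-β′ {S} {S′} {S″} {k = k} = begin
      mor (a S S′ S″) ∘ q _ _ ∘ (q S S′ ▷ obj S″) ∘ k    ≈⟨ refl⟩∘⟨ assoc ⟨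
      mor (a S S′ S″) ∘ (q _ _ ∘ (q S S′ ▷ obj S″)) ∘ k  ≈⟨ pullˡ a-β ⟩
      (q _ _ ∘ (obj S ◁ q S′ S″) ∘ α⇒ _ _ _) ∘ k         ≈⟨ assoc ⟩
      q _ _ ∘ ((obj S ◁ q S′ S″) ∘ α⇒ _ _ _) ∘ k         ≈⟨ refl⟩∘⟨ assoc ⟩
      q _ _ ∘ (obj S ◁ q S′ S″) ∘ α⇒ _ _ _ ∘ k           ∎

    l-β′ : ∀ {S A} {k : A ⇒ _} →
           mor (l S) ∘ q J S ∘ (qJ ▷ obj S) ∘ k ≈ λ⇒ (obj S) ∘ k
    l-β′ = Equiv.trans (refl⟩∘⟨ Equiv.sym assoc) (pullˡ l-β)

    ⊠-resp : ∀ {S₁ S₂ S₁′ S₂′} {f g : S₁ ⇒/ S₂} {f′ g′ : S₁′ ⇒/ S₂′} →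
             mor f ≈ mor g → mor f′ ≈ mor g′ → mor (f ⊠₁ f′) ≈ mor (g ⊠₁ g′)
    ⊠-resp {f = f} {g} {f′} {g′} p p′ = cancel q∈E (f ⊠₁ f′) (g ⊠₁ g′)
      (Equiv.trans ⊠-β (Equiv.trans (refl⟩∘⟨ ⊗-resp-≈ p p′) (Equiv.sym ⊠-β)))

    ⊠-id : ∀ {S S′} → mor (id/ {S} ⊠₁ id/ {S′}) ≈ id
    ⊠-id {S} {S′} = cancel q∈E (id/ {S} ⊠₁ id/ {S′}) id/ (begin
      mor (id/ {S} ⊠₁ id/ {S′}) ∘ q S S′  ≈⟨ ⊠-β ⟩
      q S S′ ∘ (id ⊗₁ id)                 ≈⟨ refl⟩∘⟨ ⊗-identity ⟩
      q S S′ ∘ id                         ≈⟨ identityʳ ⟩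
      q S S′                              ≈⟨ identityˡ ⟨
      id ∘ q S S′                         ∎)

    ⊠-comp : ∀ {S₁ S₂ S₃ S₁′ S₂′ S₃′} {f : S₁ ⇒/ S₂} {g : S₂ ⇒/ S₃}
             {f′ : S₁′ ⇒/ S₂′} {g′ : S₂′ ⇒/ S₃′} →
             mor ((g ∘/ f) ⊠₁ (g′ ∘/ f′)) ≈ mor (g ⊠₁ g′) ∘ mor (f ⊠₁ f′)
    ⊠-comp {f = f} {g} {f′} {g′} =
      cancel q∈E ((g ∘/ f) ⊠₁ (g′ ∘/ f′)) ((g ⊠₁ g′) ∘/ (f ⊠₁ f′)) (begin
      mor ((g ∘/ f) ⊠₁ (g′ ∘/ f′)) ∘ q _ _              ≈⟨ ⊠-β ⟩
      q _ _ ∘ ((mor g ∘ mor f) ⊗₁ (mor g′ ∘ mor f′))    ≈⟨ refl⟩∘⟨ ⊗-∘ ⟩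
      q _ _ ∘ (mor g ⊗₁ mor g′) ∘ (mor f ⊗₁ mor f′)     ≈⟨ extendʳ ⊠-β ⟨
      mor (g ⊠₁ g′) ∘ q _ _ ∘ (mor f ⊗₁ mor f′)         ≈⟨ refl⟩∘⟨ ⊠-β ⟨
      mor (g ⊠₁ g′) ∘ mor (f ⊠₁ f′) ∘ q _ _             ≈⟨ assoc ⟨
      (mor (g ⊠₁ g′) ∘ mor (f ⊠₁ f′)) ∘ q _ _           ∎)

    l-nat : ∀ {S S′} {f : S ⇒/ S′} → mor (l S′) ∘ mor (id/ {J} ⊠₁ f) ≈ mor f ∘ mor (l S)
    l-nat {S} {S′} {f} = cancel qλ∈E (l S′ ∘/ (id/ ⊠₁ f)) (f ∘/ l S) (begin
      (mor (l S′) ∘ mor (id/ {J} ⊠₁ f)) ∘ q J S ∘ (qJ ▷ obj S)  ≈⟨ assoc ⟩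
      mor (l S′) ∘ mor (id/ {J} ⊠₁ f) ∘ q J S ∘ (qJ ▷ obj S)    ≈⟨ refl⟩∘⟨ extendʳ ⊠-β ⟩
      mor (l S′) ∘ q J S′ ∘ (obj J ◁ mor f) ∘ (qJ ▷ obj S)      ≈⟨ refl⟩∘⟨ refl⟩∘⟨ slide ⟨
      mor (l S′) ∘ q J S′ ∘ (qJ ▷ obj S′) ∘ (unit ◁ mor f)      ≈⟨ l-β′ ⟩
      λ⇒ (obj S′) ∘ (unit ◁ mor f)                              ≈⟨ λ-natural ⟩
      mor f ∘ λ⇒ (obj S)                                        ≈⟨ refl⟩∘⟨ l-β ⟨
      mor f ∘ mor (l S) ∘ q J S ∘ (qJ ▷ obj S)                  ≈⟨ assoc ⟨
      (mor f ∘ mor (l S)) ∘ q J S ∘ (qJ ▷ obj S)                ∎)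

    r-nat : ∀ {S S′} {f : S ⇒/ S′} → mor (r S′) ∘ mor f ≈ mor (f ⊠₁ id/ {J}) ∘ mor (r S)
    r-nat {S} {S′} {f} = begin
      (q S′ J ∘ (obj S′ ◁ qJ) ∘ ρ⇒ _) ∘ mor f             ≈⟨ assoc ⟩
      q S′ J ∘ ((obj S′ ◁ qJ) ∘ ρ⇒ _) ∘ mor f             ≈⟨ refl⟩∘⟨ assoc ⟩
      q S′ J ∘ (obj S′ ◁ qJ) ∘ ρ⇒ _ ∘ mor f               ≈⟨ refl⟩∘⟨ refl⟩∘⟨ ρ-natural ⟩
      q S′ J ∘ (obj S′ ◁ qJ) ∘ (mor f ▷ unit) ∘ ρ⇒ _      ≈⟨ refl⟩∘⟨ extendʳ slide ⟨
      q S′ J ∘ (mor f ▷ obj J) ∘ (obj S ◁ qJ) ∘ ρ⇒ _      ≈⟨ extendʳ ⊠-β ⟨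
      mor (f ⊠₁ id/ {J}) ∘ q S J ∘ (obj S ◁ qJ) ∘ ρ⇒ _    ∎

    a-nat : ∀ {X Y Z X′ Y′ Z′} {f : X ⇒/ X′} {g : Y ⇒/ Y′} {h : Z ⇒/ Z′} →
            mor (a X′ Y′ Z′) ∘ mor ((f ⊠₁ g) ⊠₁ h) ≈ mor (f ⊠₁ (g ⊠₁ h)) ∘ mor (a X Y Z)
    a-nat {X} {Y} {Z} {X′} {Y′} {Z′} {f} {g} {h} =
      cancel qα∈E (a X′ Y′ Z′ ∘/ ((f ⊠₁ g) ⊠₁ h)) ((f ⊠₁ (g ⊠₁ h)) ∘/ a X Y Z) (begin
      (mor (a X′ Y′ Z′) ∘ mor ((f ⊠₁ g) ⊠₁ h)) ∘ q _ _ ∘ (q X Y ▷ obj Z)      ≈⟨ assoc ⟩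
      mor (a X′ Y′ Z′) ∘ mor ((f ⊠₁ g) ⊠₁ h) ∘ q _ _ ∘ (q X Y ▷ obj Z)        ≈⟨ refl⟩∘⟨ extendʳ ⊠-β ⟩
      mor (a X′ Y′ Z′) ∘ q _ _ ∘ (mor (f ⊠₁ g) ⊗₁ mor h) ∘ (q X Y ▷ obj Z)    ≈⟨ refl⟩∘⟨ refl⟩∘⟨ ⊗-▷ ⟩
      mor (a X′ Y′ Z′) ∘ q _ _ ∘ ((mor (f ⊠₁ g) ∘ q X Y) ⊗₁ mor h)            ≈⟨ refl⟩∘⟨ refl⟩∘⟨ ⊗-resp-≈ ⊠-β Equiv.refl ⟩
      mor (a X′ Y′ Z′) ∘ q _ _ ∘ ((q X′ Y′ ∘ (mor f ⊗₁ mor g)) ⊗₁ mor h)      ≈⟨ refl⟩∘⟨ refl⟩∘⟨ ▷-⊗ ⟨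
      mor (a X′ Y′ Z′) ∘ q _ _ ∘ (q X′ Y′ ▷ obj Z′) ∘ ((mor f ⊗₁ mor g) ⊗₁ mor h) ≈⟨ a-β′ ⟩
      q _ _ ∘ (obj X′ ◁ q Y′ Z′) ∘ α⇒ _ _ _ ∘ ((mor f ⊗₁ mor g) ⊗₁ mor h)     ≈⟨ refl⟩∘⟨ refl⟩∘⟨ α-natural ⟩
      q _ _ ∘ (obj X′ ◁ q Y′ Z′) ∘ (mor f ⊗₁ (mor g ⊗₁ mor h)) ∘ α⇒ _ _ _     ≈⟨ refl⟩∘⟨ pullˡ ◁-⊗ ⟩
      q _ _ ∘ (mor f ⊗₁ (q Y′ Z′ ∘ (mor g ⊗₁ mor h))) ∘ α⇒ _ _ _              ≈⟨ refl⟩∘⟨ ⊗-resp-≈ Equiv.refl ⊠-β ⟩∘⟨refl ⟨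
      q _ _ ∘ (mor f ⊗₁ (mor (g ⊠₁ h) ∘ q Y Z)) ∘ α⇒ _ _ _                    ≈⟨ refl⟩∘⟨ pullˡ ⊗-◁ ⟨
      q _ _ ∘ (mor f ⊗₁ mor (g ⊠₁ h)) ∘ (obj X ◁ q Y Z) ∘ α⇒ _ _ _            ≈⟨ extendʳ ⊠-β ⟨
      mor (f ⊠₁ (g ⊠₁ h)) ∘ q _ _ ∘ (obj X ◁ q Y Z) ∘ α⇒ _ _ _                ≈⟨ refl⟩∘⟨ a-β ⟨
      mor (f ⊠₁ (g ⊠₁ h)) ∘ mor (a X Y Z) ∘ q _ _ ∘ (q X Y ▷ obj Z)           ≈⟨ assoc ⟨
      (mor (f ⊠₁ (g ⊠₁ h)) ∘ mor (a X Y Z)) ∘ q _ _ ∘ (q X Y ▷ obj Z)         ∎)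

    lr : mor (l J) ∘ mor (r J) ≈ id
    lr = cancel qJ∈E (l J ∘/ r J) id/ (begin
      (mor (l J) ∘ mor (r J)) ∘ qJ                                   ≈⟨ assoc ⟩
      mor (l J) ∘ (q J J ∘ (obj J ◁ qJ) ∘ ρ⇒ _) ∘ qJ                 ≈⟨ refl⟩∘⟨ assoc ⟩
      mor (l J) ∘ q J J ∘ ((obj J ◁ qJ) ∘ ρ⇒ _) ∘ qJ                 ≈⟨ refl⟩∘⟨ refl⟩∘⟨ assoc ⟩
      mor (l J) ∘ q J J ∘ (obj J ◁ qJ) ∘ ρ⇒ _ ∘ qJ                   ≈⟨ refl⟩∘⟨ refl⟩∘⟨ refl⟩∘⟨ ρ-natural ⟩
      mor (l J) ∘ q J J ∘ (obj J ◁ qJ) ∘ (qJ ▷ unit) ∘ ρ⇒ unit       ≈⟨ refl⟩∘⟨ refl⟩∘⟨ extendʳ slide ⟨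
      mor (l J) ∘ q J J ∘ (qJ ▷ obj J) ∘ (unit ◁ qJ) ∘ ρ⇒ unit       ≈⟨ l-β′ ⟩
      λ⇒ (obj J) ∘ (unit ◁ qJ) ∘ ρ⇒ unit                             ≈⟨ extendʳ λ-natural ⟩
      qJ ∘ λ⇒ unit ∘ ρ⇒ unit                                         ≈⟨ refl⟩∘⟨ λρ ⟩
      qJ ∘ id                                                        ≈⟨ identityʳ ⟩
      qJ                                                             ≈⟨ identityˡ ⟨
      id ∘ qJ                                                        ∎)

    la : ∀ {X Y} → mor (l (X ⊠₀ Y)) ∘ mor (a J X Y) ≈ mor (l X ⊠₁ id/ {Y})
    la {X} {Y} =
      cancel (E-∘ qα∈E (⊗-closed Y (⊗-closed X qJ∈E)))
             (l (X ⊠₀ Y) ∘/ a J X Y) (l X ⊠₁ id/ {Y}) (begin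
      (mor (l (X ⊠₀ Y)) ∘ mor (a J X Y)) ∘ (q _ _ ∘ (q J X ▷ obj Y)) ∘ (qJ ▷ obj X ▷ obj Y)  ≈⟨ assoc ⟩
      mor (l (X ⊠₀ Y)) ∘ mor (a J X Y) ∘ (q _ _ ∘ (q J X ▷ obj Y)) ∘ (qJ ▷ obj X ▷ obj Y)    ≈⟨ refl⟩∘⟨ refl⟩∘⟨ assoc ⟩
      mor (l (X ⊠₀ Y)) ∘ mor (a J X Y) ∘ q _ _ ∘ (q J X ▷ obj Y) ∘ (qJ ▷ obj X ▷ obj Y)      ≈⟨ refl⟩∘⟨ a-β′ ⟩
      mor (l (X ⊠₀ Y)) ∘ q _ _ ∘ (obj J ◁ q X Y) ∘ α⇒ _ _ _ ∘ (qJ ▷ obj X ▷ obj Y)           ≈⟨ refl⟩∘⟨ refl⟩∘⟨ refl⟩∘⟨ α-▷ ⟩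
      mor (l (X ⊠₀ Y)) ∘ q _ _ ∘ (obj J ◁ q X Y) ∘ (qJ ▷ (obj X ⊗₀ obj Y)) ∘ α⇒ _ _ _        ≈⟨ refl⟩∘⟨ refl⟩∘⟨ extendʳ slide ⟨
      mor (l (X ⊠₀ Y)) ∘ q _ _ ∘ (qJ ▷ obj (X ⊠₀ Y)) ∘ (unit ◁ q X Y) ∘ α⇒ _ _ _             ≈⟨ l-β′ ⟩
      λ⇒ _ ∘ (unit ◁ q X Y) ∘ α⇒ _ _ _                                                       ≈⟨ extendʳ λ-natural ⟩
      q X Y ∘ λ⇒ _ ∘ α⇒ _ _ _                                                                ≈⟨ refl⟩∘⟨ λα ⟩
      q X Y ∘ (λ⇒ (obj X) ▷ obj Y)                                                           ≈⟨ refl⟩∘⟨ ▷-resp l-β ⟨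
      q X Y ∘ ((mor (l X) ∘ q J X ∘ (qJ ▷ obj X)) ▷ obj Y)                                   ≈⟨ refl⟩∘⟨ ▷-∘ ⟩
      q X Y ∘ (mor (l X) ▷ obj Y) ∘ ((q J X ∘ (qJ ▷ obj X)) ▷ obj Y)                         ≈⟨ extendʳ ⊠-β ⟨
      mor (l X ⊠₁ id/ {Y}) ∘ q _ _ ∘ ((q J X ∘ (qJ ▷ obj X)) ▷ obj Y)                        ≈⟨ refl⟩∘⟨ refl⟩∘⟨ ▷-∘ ⟩
      mor (l X ⊠₁ id/ {Y}) ∘ q _ _ ∘ (q J X ▷ obj Y) ∘ (qJ ▷ obj X ▷ obj Y)                  ≈⟨ refl⟩∘⟨ assoc ⟨
      mor (l X ⊠₁ id/ {Y}) ∘ (q _ _ ∘ (q J X ▷ obj Y)) ∘ (qJ ▷ obj X ▷ obj Y)                ∎)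

    ar : ∀ {X Y} → mor (a X Y J) ∘ mor (r (X ⊠₀ Y)) ≈ mor (id/ {X} ⊠₁ r Y)
    ar {X} {Y} = cancel q∈E (a X Y J ∘/ r (X ⊠₀ Y)) (id/ {X} ⊠₁ r Y) (begin
      (mor (a X Y J) ∘ mor (r (X ⊠₀ Y))) ∘ q X Y                                       ≈⟨ assoc ⟩
      mor (a X Y J) ∘ mor (r (X ⊠₀ Y)) ∘ q X Y                                         ≈⟨ refl⟩∘⟨ assoc ⟩
      mor (a X Y J) ∘ q _ J ∘ ((_ ◁ qJ) ∘ ρ⇒ _) ∘ q X Y                                ≈⟨ refl⟩∘⟨ refl⟩∘⟨ assoc ⟩
      mor (a X Y J) ∘ q _ J ∘ (_ ◁ qJ) ∘ ρ⇒ _ ∘ q X Y                                  ≈⟨ refl⟩∘⟨ refl⟩∘⟨ refl⟩∘⟨ ρ-natural ⟩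
      mor (a X Y J) ∘ q _ J ∘ (_ ◁ qJ) ∘ (q X Y ▷ unit) ∘ ρ⇒ _                         ≈⟨ refl⟩∘⟨ refl⟩∘⟨ extendʳ slide ⟨
      mor (a X Y J) ∘ q _ J ∘ (q X Y ▷ obj J) ∘ (_ ◁ qJ) ∘ ρ⇒ _                        ≈⟨ a-β′ ⟩
      q _ _ ∘ (obj X ◁ q Y J) ∘ α⇒ _ _ _ ∘ (_ ◁ qJ) ∘ ρ⇒ _                             ≈⟨ refl⟩∘⟨ refl⟩∘⟨ extendʳ α-◁ ⟩
      q _ _ ∘ (obj X ◁ q Y J) ∘ (obj X ◁ obj Y ◁ qJ) ∘ α⇒ _ _ _ ∘ ρ⇒ _                 ≈⟨ refl⟩∘⟨ refl⟩∘⟨ refl⟩∘⟨ αρ ⟩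
      q _ _ ∘ (obj X ◁ q Y J) ∘ (obj X ◁ obj Y ◁ qJ) ∘ (obj X ◁ ρ⇒ (obj Y))            ≈⟨ refl⟩∘⟨ refl⟩∘⟨ ◁-∘ ⟨
      q _ _ ∘ (obj X ◁ q Y J) ∘ (obj X ◁ ((obj Y ◁ qJ) ∘ ρ⇒ (obj Y)))                  ≈⟨ refl⟩∘⟨ ◁-∘ ⟨
      q _ _ ∘ (obj X ◁ mor (r Y))                                                      ≈⟨ ⊠-β ⟨
      mor (id/ {X} ⊠₁ r Y) ∘ q X Y                                                     ∎)

    lar : ∀ {X Y} → mor (id/ {X} ⊠₁ l Y) ∘ mor (a X J Y) ∘ mor (r X ⊠₁ id/ {Y}) ≈ id
    lar {X} {Y} = cancel q∈E ((id/ {X} ⊠₁ l Y) ∘/ a X J Y ∘/ (r X ⊠₁ id/ {Y})) id/ (begin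
      (mor (id/ {X} ⊠₁ l Y) ∘ mor (a X J Y) ∘ mor (r X ⊠₁ id/ {Y})) ∘ q X Y            ≈⟨ assoc ⟩
      mor (id/ {X} ⊠₁ l Y) ∘ (mor (a X J Y) ∘ mor (r X ⊠₁ id/ {Y})) ∘ q X Y            ≈⟨ refl⟩∘⟨ assoc ⟩
      mor (id/ {X} ⊠₁ l Y) ∘ mor (a X J Y) ∘ mor (r X ⊠₁ id/ {Y}) ∘ q X Y              ≈⟨ refl⟩∘⟨ refl⟩∘⟨ ⊠-β ⟩
      mor (id/ {X} ⊠₁ l Y) ∘ mor (a X J Y) ∘ q _ _ ∘ (mor (r X) ▷ obj Y)               ≈⟨ refl⟩∘⟨ refl⟩∘⟨ refl⟩∘⟨ ▷-∘ ⟩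
      mor (id/ {X} ⊠₁ l Y) ∘ mor (a X J Y) ∘ q _ _ ∘ (q X J ▷ obj Y) ∘ (((obj X ◁ qJ) ∘ ρ⇒ _) ▷ obj Y)
        ≈⟨ refl⟩∘⟨ a-β′ ⟩
      mor (id/ {X} ⊠₁ l Y) ∘ q _ _ ∘ (obj X ◁ q J Y) ∘ α⇒ _ _ _ ∘ (((obj X ◁ qJ) ∘ ρ⇒ _) ▷ obj Y)
        ≈⟨ refl⟩∘⟨ refl⟩∘⟨ refl⟩∘⟨ refl⟩∘⟨ ▷-∘ ⟩
      mor (id/ {X} ⊠₁ l Y) ∘ q _ _ ∘ (obj X ◁ q J Y) ∘ α⇒ _ _ _ ∘ ((obj X ◁ qJ) ▷ obj Y) ∘ (ρ⇒ _ ▷ obj Y)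
        ≈⟨ refl⟩∘⟨ refl⟩∘⟨ refl⟩∘⟨ extendʳ α-natural ⟩
      mor (id/ {X} ⊠₁ l Y) ∘ q _ _ ∘ (obj X ◁ q J Y) ∘ (obj X ◁ (qJ ▷ obj Y)) ∘ α⇒ _ _ _ ∘ (ρ⇒ _ ▷ obj Y)
        ≈⟨ extendʳ ⊠-β ⟩
      q X Y ∘ (obj X ◁ mor (l Y)) ∘ (obj X ◁ q J Y) ∘ (obj X ◁ (qJ ▷ obj Y)) ∘ α⇒ _ _ _ ∘ (ρ⇒ _ ▷ obj Y)
        ≈⟨ refl⟩∘⟨ refl⟩∘⟨ pullˡ (Equiv.sym ◁-∘) ⟩
      q X Y ∘ (obj X ◁ mor (l Y)) ∘ (obj X ◁ (q J Y ∘ (qJ ▷ obj Y))) ∘ α⇒ _ _ _ ∘ (ρ⇒ _ ▷ obj Y)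
        ≈⟨ refl⟩∘⟨ pullˡ (Equiv.trans (Equiv.sym ◁-∘) (◁-resp l-β)) ⟩
      q X Y ∘ (obj X ◁ λ⇒ (obj Y)) ∘ α⇒ _ _ _ ∘ (ρ⇒ _ ▷ obj Y)                         ≈⟨ refl⟩∘⟨ triangle ⟩
      q X Y ∘ id                                                                       ≈⟨ identityʳ ⟩
      q X Y                                                                            ≈⟨ identityˡ ⟨
      id ∘ q X Y                                                                       ∎)

    aaa : ∀ {W X Y Z} →
          mor (id/ {W} ⊠₁ a X Y Z) ∘ mor (a W (X ⊠₀ Y) Z) ∘ mor (a W X Y ⊠₁ id/ {Z})
          ≈ mor (a W X (Y ⊠₀ Z)) ∘ mor (a (W ⊠₀ X) Y Z)
    aaa {W} {X} {Y} {Z} =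
      cancel (E-∘ q∈E (⊗-closed Z qα∈E))
             ((id/ {W} ⊠₁ a X Y Z) ∘/ a W (X ⊠₀ Y) Z ∘/ (a W X Y ⊠₁ id/ {Z}))
             (a W X (Y ⊠₀ Z) ∘/ a (W ⊠₀ X) Y Z)
             (Equiv.trans lhs (Equiv.sym rhs))
      where
      w = obj W
      x = obj X
      y = obj Y
      z = obj Z

      Q : ((w ⊗₀ x) ⊗₀ y) ⊗₀ z ⇒ obj (((W ⊠₀ X) ⊠₀ Y) ⊠₀ Z)
      Q = q _ Z ∘ ((q _ Y ∘ (q W X ▷ y)) ▷ z)

      common : ((w ⊗₀ x) ⊗₀ y) ⊗₀ z ⇒ obj (W ⊠₀ (X ⊠₀ (Y ⊠₀ Z)))
      common = q W _ ∘ (w ◁ q X _) ∘ (w ◁ x ◁ q Y Z) ∘ α⇒ w x (y ⊗₀ z) ∘ α⇒ (w ⊗₀ x) y z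

      inner : mor (a X Y Z) ∘ q _ Z ∘ (q X Y ▷ z) ≈ q X _ ∘ (x ◁ q Y Z) ∘ α⇒ x y z
      inner = a-β

      lhs : (mor (id/ {W} ⊠₁ a X Y Z) ∘ mor (a W (X ⊠₀ Y) Z) ∘ mor (a W X Y ⊠₁ id/ {Z})) ∘ Q ≈ common
      lhs = begin
        (mor (id/ {W} ⊠₁ a X Y Z) ∘ mor (a W (X ⊠₀ Y) Z) ∘ mor (a W X Y ⊠₁ id/ {Z})) ∘ Q  ≈⟨ assoc ⟩
        mor (id/ {W} ⊠₁ a X Y Z) ∘ (mor (a W (X ⊠₀ Y) Z) ∘ mor (a W X Y ⊠₁ id/ {Z})) ∘ Q  ≈⟨ refl⟩∘⟨ assoc ⟩
        mor (id/ {W} ⊠₁ a X Y Z) ∘ mor (a W (X ⊠₀ Y) Z) ∘ mor (a W X Y ⊠₁ id/ {Z}) ∘ Q    ≈⟨ refl⟩∘⟨ refl⟩∘⟨ extendʳ ⊠-β ⟩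
        mor (id/ {W} ⊠₁ a X Y Z) ∘ mor (a W (X ⊠₀ Y) Z) ∘ q _ Z ∘ (mor (a W X Y) ▷ z) ∘ ((q _ Y ∘ (q W X ▷ y)) ▷ z)
          ≈⟨ refl⟩∘⟨ refl⟩∘⟨ refl⟩∘⟨ Equiv.trans (Equiv.sym ▷-∘) (▷-resp a-β) ⟩
        mor (id/ {W} ⊠₁ a X Y Z) ∘ mor (a W (X ⊠₀ Y) Z) ∘ q _ Z ∘ ((q W _ ∘ (w ◁ q X Y) ∘ α⇒ w x y) ▷ z)
          ≈⟨ refl⟩∘⟨ refl⟩∘⟨ refl⟩∘⟨ Equiv.trans ▷-∘ (refl⟩∘⟨ ▷-∘) ⟩
        mor (id/ {W} ⊠₁ a X Y Z) ∘ mor (a W (X ⊠₀ Y) Z) ∘ q _ Z ∘ (q W _ ▷ z) ∘ ((w ◁ q X Y) ▷ z) ∘ (α⇒ w x y ▷ z)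
          ≈⟨ refl⟩∘⟨ a-β′ ⟩
        mor (id/ {W} ⊠₁ a X Y Z) ∘ q W _ ∘ (w ◁ q _ Z) ∘ α⇒ _ _ _ ∘ ((w ◁ q X Y) ▷ z) ∘ (α⇒ w x y ▷ z)
          ≈⟨ refl⟩∘⟨ refl⟩∘⟨ refl⟩∘⟨ extendʳ α-natural ⟩
        mor (id/ {W} ⊠₁ a X Y Z) ∘ q W _ ∘ (w ◁ q _ Z) ∘ (w ◁ (q X Y ▷ z)) ∘ α⇒ _ _ _ ∘ (α⇒ w x y ▷ z)
          ≈⟨ extendʳ ⊠-β ⟩
        q W _ ∘ (w ◁ mor (a X Y Z)) ∘ (w ◁ q _ Z) ∘ (w ◁ (q X Y ▷ z)) ∘ α⇒ _ _ _ ∘ (α⇒ w x y ▷ z)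
          ≈⟨ refl⟩∘⟨ refl⟩∘⟨ pullˡ (Equiv.sym ◁-∘) ⟩
        q W _ ∘ (w ◁ mor (a X Y Z)) ∘ (w ◁ (q _ Z ∘ (q X Y ▷ z))) ∘ α⇒ _ _ _ ∘ (α⇒ w x y ▷ z)
          ≈⟨ refl⟩∘⟨ pullˡ (Equiv.trans (Equiv.sym ◁-∘) (◁-resp inner)) ⟩
        q W _ ∘ (w ◁ (q X _ ∘ (x ◁ q Y Z) ∘ α⇒ x y z)) ∘ α⇒ _ _ _ ∘ (α⇒ w x y ▷ z)
          ≈⟨ refl⟩∘⟨ pushˡ ◁-∘ ⟩
        q W _ ∘ (w ◁ q X _) ∘ (w ◁ ((x ◁ q Y Z) ∘ α⇒ x y z)) ∘ α⇒ _ _ _ ∘ (α⇒ w x y ▷ z)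
          ≈⟨ refl⟩∘⟨ refl⟩∘⟨ pushˡ ◁-∘ ⟩
        q W _ ∘ (w ◁ q X _) ∘ (w ◁ x ◁ q Y Z) ∘ (w ◁ α⇒ x y z) ∘ α⇒ _ _ _ ∘ (α⇒ w x y ▷ z)
          ≈⟨ refl⟩∘⟨ refl⟩∘⟨ refl⟩∘⟨ pentagon ⟩
        common ∎

      rhs : (mor (a W X (Y ⊠₀ Z)) ∘ mor (a (W ⊠₀ X) Y Z)) ∘ Q ≈ common
      rhs = begin
        (mor (a W X (Y ⊠₀ Z)) ∘ mor (a (W ⊠₀ X) Y Z)) ∘ Q                                 ≈⟨ assoc ⟩
        mor (a W X (Y ⊠₀ Z)) ∘ mor (a (W ⊠₀ X) Y Z) ∘ Q                                   ≈⟨ refl⟩∘⟨ refl⟩∘⟨ refl⟩∘⟨ ▷-∘ ⟩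
        mor (a W X (Y ⊠₀ Z)) ∘ mor (a (W ⊠₀ X) Y Z) ∘ q _ Z ∘ (q _ Y ▷ z) ∘ (q W X ▷ y ▷ z)
          ≈⟨ refl⟩∘⟨ a-β′ ⟩
        mor (a W X (Y ⊠₀ Z)) ∘ q _ _ ∘ (_ ◁ q Y Z) ∘ α⇒ _ _ _ ∘ (q W X ▷ y ▷ z)           ≈⟨ refl⟩∘⟨ refl⟩∘⟨ refl⟩∘⟨ α-▷ ⟩
        mor (a W X (Y ⊠₀ Z)) ∘ q _ _ ∘ (_ ◁ q Y Z) ∘ (q W X ▷ (y ⊗₀ z)) ∘ α⇒ _ _ _        ≈⟨ refl⟩∘⟨ refl⟩∘⟨ extendʳ slide ⟨
        mor (a W X (Y ⊠₀ Z)) ∘ q _ _ ∘ (q W X ▷ _) ∘ ((w ⊗₀ x) ◁ q Y Z) ∘ α⇒ _ _ _        ≈⟨ a-β′ ⟩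
        q W _ ∘ (w ◁ q X _) ∘ α⇒ _ _ _ ∘ ((w ⊗₀ x) ◁ q Y Z) ∘ α⇒ _ _ _                    ≈⟨ refl⟩∘⟨ refl⟩∘⟨ extendʳ α-◁ ⟩
        common ∎

  skewMonoidal : SkewMonoidal (Slice 𝖳 F)
  skewMonoidal = record
    { unit = J
    ; _⊗₀_ = _⊠₀_
    ; _⊗₁_ = _⊠₁_
    ; ⊗-resp-≈ = λ {_} {_} {_} {_} {f} {g} {f′} {g′} → ⊠-resp {f = f} {g} {f′} {g′}
    ; ⊗-identity = ⊠-id
    ; ⊗-∘ = λ {_} {_} {_} {_} {_} {_} {f} {g} {f′} {g′} → ⊠-comp {f = f} {g} {f′} {g′}
    ; λ⇒ = l
    ; ρ⇒ = r
    ; α⇒ = a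
    ; λ-natural = λ {_} {_} {f} → l-nat {f = f}
    ; ρ-natural = λ {_} {_} {f} → r-nat {f = f}
    ; α-natural = λ {_} {_} {_} {_} {_} {_} {f} {g} {h} → a-nat {f = f} {g} {h}
    ; λρ = lr
    ; λα = la
    ; αρ = ar
    ; triangle = lar
    ; pentagon = aaa
    }

  T-lax : LaxMonoidalFunctor skewMonoidal skew
  T-lax = record
    { functor = record
        { F₀ = obj
        ; F₁ = mor
        ; F-resp-≈ = λ eq → eq
        ; identity = Equiv.refl
        ; homomorphism = Equiv.refl
        }
    ; η = qJ
    ; μ = q
    ; μ-natural = Equiv.sym ⊠-β
    ; unitˡ = l-β
    ; unitʳ = Equiv.refl
    ; assoc-μ = a-β
    }

  module _ (mon : IsMonoidal skewMonoidal) where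

    monoidal : Monoidal (Slice 𝖳 F)
    monoidal = record { skew = skewMonoidal ; isMonoidal = mon }

    T-grading : Grading 𝖳 F monoidal
    T-grading = record
      { lax = T-lax
      ; g = arr
      ; g∈M = arr∈M
      ; g-natural = tri
      ; g-unit = arr-qJ
      ; g-mult = λ _ _ → arr-q
      }

  module CanonicalOperation
    (P : FiniteProducts C)
    (canonical∈E : ContainsCanonical F P V)
    (∏-closed : ProductClosed F P)
    {n : ℕ} (φ : FiniteProducts._^_ P T n ⇒ T) (φ-algebraic : IsAlgebraic P 𝖳 φ)
    (R : Fin n → SliceObj 𝖳 F)
    (φ-factor : Factorization (φ ∘ FiniteProducts.∏₁ P (λ i → arr (R i))))
    where

    open FiniteProducts P

    R′ : SliceObj 𝖳 F
    R′ = sliceObj (right φ-factor) (right∈M φ-factor)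

    p : ∏ (λ i → obj (R i)) ⇒ obj R′
    p = left φ-factor

    IsComponent : ∀ S → ∏ (λ i → obj (R i ⊠₀ S)) ⇒ obj (R′ ⊠₀ S) → Set e
    IsComponent S ψ =
      ψ ∘ ∏₁ (λ i → q (R i) S) ∘ ⟨ (λ i → π i ▷ obj S) ⟩ ≈ q R′ S ∘ (p ▷ obj S)
      × arr (R′ ⊠₀ S) ∘ ψ ≈ φ ∘ ∏₁ (λ i → arr (R i ⊠₀ S))

    component : ∀ S → ∃! _≈_ (IsComponent S)
    component S =
      diagonal (E-∘ (∏-closed λ _ → q∈E) (canonical∈E (λ i → obj (R i)) (obj S)))
               (arr∈M (R′ ⊠₀ S)) (begin
      (φ ∘ ∏₁ (λ i → arr (R i ⊠₀ S))) ∘ ∏₁ (λ i → q (R i) S) ∘ ⟨ (λ i → π i ▷ obj S) ⟩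
        ≈⟨ assoc ⟩
      φ ∘ ∏₁ (λ i → arr (R i ⊠₀ S)) ∘ ∏₁ (λ i → q (R i) S) ∘ ⟨ (λ i → π i ▷ obj S) ⟩
        ≈⟨ refl⟩∘⟨ refl⟩∘⟨ ∏₁-⟨⟩ ⟩
      φ ∘ ∏₁ (λ i → arr (R i ⊠₀ S)) ∘ ⟨ (λ i → q (R i) S ∘ (π i ▷ obj S)) ⟩
        ≈⟨ refl⟩∘⟨ ∏₁-⟨⟩ ⟩
      φ ∘ ⟨ (λ i → arr (R i ⊠₀ S) ∘ q (R i) S ∘ (π i ▷ obj S)) ⟩
        ≈⟨ refl⟩∘⟨ ⟨⟩-cong (λ i → begin
             arr (R i ⊠₀ S) ∘ q (R i) S ∘ (π i ▷ obj S)            ≈⟨ extendʳ arr-q ⟩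
             μ ∘ (arr (R i) ⊗₁ arr S) ∘ (π i ▷ obj S)              ≈⟨ refl⟩∘⟨ ⊗-▷ ⟩
             μ ∘ ((arr (R i) ∘ π i) ⊗₁ arr S)                      ≈⟨ refl⟩∘⟨ ⊗-resp-≈ (project i) Equiv.refl ⟨
             μ ∘ ((π i ∘ ∏₁ (λ j → arr (R j))) ⊗₁ arr S)           ≈⟨ refl⟩∘⟨ ▷-⊗ ⟨
             μ ∘ (π i ▷ T) ∘ (∏₁ (λ j → arr (R j)) ⊗₁ arr S)       ≈⟨ assoc ⟨
             (μ ∘ (π i ▷ T)) ∘ (∏₁ (λ j → arr (R j)) ⊗₁ arr S)     ∎) ⟩
      φ ∘ ⟨ (λ i → (μ ∘ (π i ▷ T)) ∘ (∏₁ (λ j → arr (R j)) ⊗₁ arr S)) ⟩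
        ≈⟨ refl⟩∘⟨ ⟨⟩-∘ ⟨
      φ ∘ ⟨ (λ i → μ ∘ (π i ▷ T)) ⟩ ∘ (∏₁ (λ j → arr (R j)) ⊗₁ arr S)
        ≈⟨ refl⟩∘⟨ pushˡ (Equiv.sym ∏₁-⟨⟩) ⟩
      φ ∘ ∏₁ (λ _ → μ) ∘ ⟨ (λ i → π i ▷ T) ⟩ ∘ (∏₁ (λ j → arr (R j)) ⊗₁ arr S)
        ≈⟨ refl⟩∘⟨ assoc ⟨
      φ ∘ (∏₁ (λ _ → μ) ∘ ⟨ (λ i → π i ▷ T) ⟩) ∘ (∏₁ (λ j → arr (R j)) ⊗₁ arr S)
        ≈⟨ extendʳ φ-algebraic ⟩
      μ ∘ (φ ▷ T) ∘ (∏₁ (λ j → arr (R j)) ⊗₁ arr S)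
        ≈⟨ refl⟩∘⟨ ▷-⊗ ⟩
      μ ∘ ((φ ∘ ∏₁ (λ j → arr (R j))) ⊗₁ arr S)
        ≈⟨ refl⟩∘⟨ ⊗-resp-≈ (factors φ-factor) Equiv.refl ⟩
      μ ∘ ((arr R′ ∘ p) ⊗₁ arr S)
        ≈⟨ refl⟩∘⟨ ⊗-▷ ⟨
      μ ∘ (arr R′ ⊗₁ arr S) ∘ (p ▷ obj S)
        ≈⟨ extendʳ arr-q ⟨
      arr (R′ ⊠₀ S) ∘ q R′ S ∘ (p ▷ obj S) ∎)

    ψ : ∀ S → ∏ (λ i → obj (R i ⊠₀ S)) ⇒ obj (R′ ⊠₀ S)
    ψ S = proj₁ (component S)

{-# OPTIONS --safe #-}
-- Of T_M itself only three facts matter: its multiplications q lie in E, its maps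
-- to T are natural and lie in M, and any map of C over T between slice objects
-- is a morphism of M/T.
-- Let χ S : (∏ Rᵢ) ⊗ S → ∏ (Rᵢ ⊠ S) have components q ∘ (πᵢ ⊗ S). It lies in E
-- and ψ S ∘ χ S ≈ q ∘ (p ⊗ S), so ψ S lies in E by cancellation. Two maps agree
-- once they agree after an E-map and before an M-map; taking the E-map to be χ
-- and the M-map to be the map to T turns equations about ψ into ones about q.
--
-- An operation ψ′ grading φ is determined by its component at the unit J: its
-- algebraicity at (J , S), naturality along J ⊠ S → S and the triangle identity
-- give ψ′ S ∘ χ S ≈ q ∘ (u ⊗ S) with u = r⁻¹ ∘ ψ′ J ∘ ∏ r : ∏ Rᵢ → R″. So f is
-- the comparison map exactly when f ∘ p ≈ u, and such an f is a diagonal.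
module Submission where

open import Defs
open import Level using (Level)
open import Data.Nat.Base using (ℕ)
open import Data.Fin.Base using (Fin)
open import Data.Product using (∃!; _×_; _,_; proj₁; proj₂)

-- Whiskering in a monoidal category.

module _ {o ℓ e : Level} {C : Category o ℓ e} (V : Monoidal C) where
  open Category C
  open Monoidal V

  ⊗-absorb-▷ : ∀ {A B D A′ B′} {f : A ⇒ B} {g : B ⇒ D} {h : A′ ⇒ B′} →
               (g ⊗₁ h) ∘ (f ▷ A′) ≈ (g ∘ f) ⊗₁ h
  ⊗-absorb-▷ = Equiv.trans (Equiv.sym ⊗-∘) (⊗-resp-≈ Equiv.refl identityʳ)

  ▷-absorb-⊗ : ∀ {A B D A′ B′} {f : A ⇒ B} {g : B ⇒ D} {h : A′ ⇒ B′} →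
               (g ▷ B′) ∘ (f ⊗₁ h) ≈ (g ∘ f) ⊗₁ h
  ▷-absorb-⊗ = Equiv.trans (Equiv.sym ⊗-∘) (⊗-resp-≈ Equiv.refl identityˡ)

  ▷-resp-≈ : ∀ {X A B} {f g : A ⇒ B} → f ≈ g → f ▷ X ≈ g ▷ X
  ▷-resp-≈ eq = ⊗-resp-≈ eq Equiv.refl

  ▷-∘ : ∀ {X A B D} {g : B ⇒ D} {f : A ⇒ B} → (g ∘ f) ▷ X ≈ (g ▷ X) ∘ (f ▷ X)
  ▷-∘ = Equiv.sym ⊗-absorb-▷

  ▷-◁-interchange : ∀ {A B A′ B′} {f : A ⇒ B} {g : A′ ⇒ B′} →
                    (f ▷ B′) ∘ (A ◁ g) ≈ (B ◁ g) ∘ (f ▷ A′)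
  ▷-◁-interchange = Equiv.trans ▷-absorb-⊗
    (Equiv.trans (⊗-resp-≈ (Equiv.trans identityʳ (Equiv.sym identityˡ)) Equiv.refl)
                 (Equiv.sym ⊗-absorb-▷))

  α-natural-▷ : ∀ {A B X Y} {f : A ⇒ B} →
                α⇒ B X Y ∘ (f ▷ X ▷ Y) ≈ (f ▷ (X ⊗₀ Y)) ∘ α⇒ A X Y
  α-natural-▷ = Equiv.trans α-natural (⊗-resp-≈ Equiv.refl ⊗-identity ⟩∘⟨refl)

-- Cancellation in an orthogonal factorization system.

module _ {o ℓ e ε m : Level} {C : Category o ℓ e}
         (F : OrthogonalFactorizationSystem C ε m) where
  open Category C
  open HomReasoning
  open OrthogonalFactorizationSystem F

  -- Both `f` and `g` are diagonals of the square with sides `g ∘ p` and `i ∘ g`.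
  EM-cancel : ∀ {A B X Y} {p : A ⇒ B} {i : X ⇒ Y} {f g : B ⇒ X} → E p → M i →
              f ∘ p ≈ g ∘ p → i ∘ f ≈ i ∘ g → f ≈ g
  EM-cancel p∈E i∈M fp≈gp if≈ig =
    let _ , _ , uniq = diagonal p∈E i∈M assoc
    in Equiv.trans (Equiv.sym (uniq (fp≈gp , if≈ig))) (uniq (Equiv.refl , Equiv.refl))

  -- The M-part of g is an isomorphism, its inverse being a diagonal.
  E-cancelʳ : ∀ {A B D} {f : A ⇒ B} {g : B ⇒ D} → E f → E (g ∘ f) → E g
  E-cancelʳ {f = f} {g} f∈E gf∈E =
    E-resp-≈ (Equiv.sym g≈kc) (E-∘ (E-iso k-iso) c∈E)
    where
    open EMFactorization (factorize g)
      renaming (left to c; right to k; left∈E to c∈E; right∈M to k∈M; factors to g≈kc)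

    filler : ∃! _≈_ λ d → d ∘ (g ∘ f) ≈ c ∘ f × k ∘ d ≈ id
    filler = diagonal gf∈E k∈M
      (Equiv.trans identityˡ (Equiv.trans (g≈kc ⟩∘⟨refl) assoc))

    d = proj₁ filler
    d-β = proj₁ (proj₁ (proj₂ filler))
    k∘d≈id = proj₂ (proj₁ (proj₂ filler))

    d∘k≈id : d ∘ k ≈ id
    -- `d` is known only on `g ∘ f`, so the E-map to test against is `c ∘ f` rather than `c`.
    d∘k≈id = EM-cancel (E-∘ c∈E f∈E) k∈M
      (begin
        (d ∘ k) ∘ c ∘ f  ≈⟨ assoc ⟩
        d ∘ k ∘ c ∘ f    ≈⟨ refl⟩∘⟨ pullˡ (Equiv.sym g≈kc) ⟩
        d ∘ g ∘ f        ≈⟨ d-β ⟩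
        c ∘ f            ≈⟨ identityˡ ⟨
        id ∘ c ∘ f       ∎)
      (begin
        k ∘ d ∘ k  ≈⟨ pullˡ k∘d≈id ⟩
        id ∘ k     ≈⟨ identityˡ ⟩
        k          ≈⟨ identityʳ ⟨
        k ∘ id     ∎)

    k-iso : IsIso k
    k-iso = record { inv = d ; isoˡ = d∘k≈id ; isoʳ = k∘d≈id }

-- Algebraic operations for a graded monoid with multiplications in E.

module GradedOperations
  {o ℓ e ε m o′ ℓ′ e′ : Level} {C : Category o ℓ e} {V : Monoidal C}
  (P : FiniteProducts C) {𝖳 : Monoid V}
  {F : OrthogonalFactorizationSystem C ε m}
  {G : Category o′ ℓ′ e′} {U : Monoidal G} (γ : Grading 𝖳 F U)
  (μᴳ∈E : ∀ {x y} → OrthogonalFactorizationSystem.E F (LaxMonoidalFunctor.μ (Grading.lax γ) x y))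
  (▷-closed : ∀ d {A B} {f : Category._⇒_ C A B} → OrthogonalFactorizationSystem.E F f →
              OrthogonalFactorizationSystem.E F
                (Monoidal._▷_ V f (LaxMonoidalFunctor.F₀ (Grading.lax γ) d)))
  (canonical∈E : ContainsCanonical F P V)
  (∏-closed : ProductClosed F P)
  {n : ℕ} (φ : Category._⇒_ C (FiniteProducts._^_ P (Monoid.T 𝖳) n) (Monoid.T 𝖳))
  (φ-algebraic : IsAlgebraic P 𝖳 φ)
  where

  open Category C
  open HomReasoning
  open Monoidal V
  open FiniteProducts P
  open Monoid 𝖳
  open OrthogonalFactorizationSystem F
  open Grading γ
  open LaxMonoidalFunctor lax using (F₀; F₁; F-resp-≈; identity; homomorphism)
    renaming (η to ηᴳ; μ to μᴳ; μ-natural to μᴳ-natural; unitʳ to unitᴳʳ; assoc-μ to assoc-μᴳ)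
  private
    module G = Category G
    module U = Monoidal U

  ∏F : (Fin n → G.Obj) → Obj
  ∏F d = ∏ (λ i → F₀ (d i))

  ∏g : (d : Fin n → G.Obj) → ∏F d ⇒ T ^ n
  ∏g d = ∏₁ (λ i → g (d i))

  -- Kept as this composite, and not as a single tuple, so that the equations of `IsGradedAlgebraic`
  -- and `IsComponent` mention `χ` by definition and membership in E follows factor by factor.
  χ : ∀ (d : Fin n → G.Obj) x → ∏F d ⊗₀ F₀ x ⇒ ∏F (λ i → d i U.⊗₀ x)
  χ d x = ∏₁ (λ i → μᴳ (d i) x) ∘ ⟨ (λ i → π i ▷ F₀ x) ⟩

  χ∈E : ∀ d x → E (χ d x)
  χ∈E d x = E-∘ (∏-closed λ _ → μᴳ∈E) (canonical∈E (λ i → F₀ (d i)) (F₀ x))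

  ∏₁-χ : ∀ {d x} {Y : Fin n → Obj} {f : ∀ i → F₀ (d i U.⊗₀ x) ⇒ Y i} →
         ∏₁ f ∘ χ d x ≈ ⟨ (λ i → f i ∘ μᴳ (d i) x ∘ (π i ▷ F₀ x)) ⟩
  ∏₁-χ = Equiv.trans (refl⟩∘⟨ ∏₁-⟨⟩) ∏₁-⟨⟩

  ∏₁-id : ∀ {X : Fin n → Obj} {f : ∀ i → X i ⇒ X i} → (∀ i → f i ≈ id) → ∏₁ f ≈ id
  ∏₁-id eq = unique λ i →
    Equiv.trans identityʳ (Equiv.sym (Equiv.trans (eq i ⟩∘⟨refl) identityˡ))

  -- On each factor this is naturality of `μᴳ`.
  χ-natural : ∀ {d d′ x y} {f : ∀ i → d i G.⇒ d′ i} {h : x G.⇒ y} →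
              ∏₁ (λ i → F₁ (f i U.⊗₁ h)) ∘ χ d x
              ≈ χ d′ y ∘ (∏₁ (λ i → F₁ (f i)) ⊗₁ F₁ h)
  χ-natural {d} {d′} {x} {y} {f} {h} = begin
    ∏₁ (λ i → F₁ (f i U.⊗₁ h)) ∘ χ d x
      ≈⟨ ∏₁-χ ⟩
    ⟨ (λ i → F₁ (f i U.⊗₁ h) ∘ μᴳ (d i) x ∘ (π i ▷ F₀ x)) ⟩
      ≈⟨ ⟨⟩-cong (λ i → begin
           F₁ (f i U.⊗₁ h) ∘ μᴳ (d i) x ∘ (π i ▷ F₀ x)       ≈⟨ extendʳ μᴳ-natural ⟨
           μᴳ (d′ i) y ∘ (F₁ (f i) ⊗₁ F₁ h) ∘ (π i ▷ F₀ x)   ≈⟨ refl⟩∘⟨ ⊗-absorb-▷ V ⟩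
           μᴳ (d′ i) y ∘ ((F₁ (f i) ∘ π i) ⊗₁ F₁ h)
             -- Pulling `π i` out to the left leaves a right-hand factor independent of `i`, which
             -- can then leave the tuple by `⟨⟩-∘`.
             ≈⟨ refl⟩∘⟨ ⊗-resp-≈ (project i) Equiv.refl ⟨
           μᴳ (d′ i) y ∘ ((π i ∘ ∏₁ (λ j → F₁ (f j))) ⊗₁ F₁ h)
             ≈⟨ refl⟩∘⟨ ▷-absorb-⊗ V ⟨
           μᴳ (d′ i) y ∘ (π i ▷ F₀ y) ∘ (∏₁ (λ j → F₁ (f j)) ⊗₁ F₁ h)
             ≈⟨ assoc ⟨
           (μᴳ (d′ i) y ∘ (π i ▷ F₀ y)) ∘ (∏₁ (λ j → F₁ (f j)) ⊗₁ F₁ h) ∎) ⟩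
    ⟨ (λ i → (μᴳ (d′ i) y ∘ (π i ▷ F₀ y)) ∘ (∏₁ (λ j → F₁ (f j)) ⊗₁ F₁ h)) ⟩
      ≈⟨ ⟨⟩-∘ ⟨
    ⟨ (λ i → μᴳ (d′ i) y ∘ (π i ▷ F₀ y)) ⟩ ∘ (∏₁ (λ j → F₁ (f j)) ⊗₁ F₁ h)
      ≈⟨ ∏₁-⟨⟩ ⟩∘⟨refl ⟨
    χ d′ y ∘ (∏₁ (λ j → F₁ (f j)) ⊗₁ F₁ h) ∎

  χ-natural-◁ : ∀ {d x y} {h : x G.⇒ y} →
                ∏₁ (λ i → F₁ (d i U.◁ h)) ∘ χ d x ≈ χ d y ∘ (∏F d ◁ F₁ h)
  χ-natural-◁ = Equiv.trans χ-natural
    (refl⟩∘⟨ ⊗-resp-≈ (∏₁-id λ _ → identity) Equiv.refl)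

  -- Associativity of `μᴳ` with `k` slid through. The free `k` serves twice: it is `π i` in `∏₁-α-χ`
  -- and `p` in `ψ-algebraic`.
  α-μᴳ-▷ : ∀ {d x y A} {k : A ⇒ F₀ d} →
           F₁ (U.α⇒ d x y) ∘ μᴳ (d U.⊗₀ x) y ∘ ((μᴳ d x ∘ (k ▷ F₀ x)) ▷ F₀ y)
           ≈ μᴳ d (x U.⊗₀ y) ∘ (k ▷ F₀ (x U.⊗₀ y)) ∘ (A ◁ μᴳ x y) ∘ α⇒ A (F₀ x) (F₀ y)
  α-μᴳ-▷ {d} {x} {y} {A} {k} = begin
    F₁ (U.α⇒ d x y) ∘ μᴳ _ y ∘ ((μᴳ d x ∘ (k ▷ F₀ x)) ▷ F₀ y)
      ≈⟨ refl⟩∘⟨ Equiv.trans (refl⟩∘⟨ ▷-∘ V) (Equiv.sym assoc) ⟩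
    F₁ (U.α⇒ d x y) ∘ (μᴳ _ y ∘ (μᴳ d x ▷ F₀ y)) ∘ (k ▷ F₀ x ▷ F₀ y)
      ≈⟨ extendʳ assoc-μᴳ ⟩
    μᴳ d _ ∘ ((F₀ d ◁ μᴳ x y) ∘ α⇒ _ _ _) ∘ (k ▷ F₀ x ▷ F₀ y)
      ≈⟨ refl⟩∘⟨ Equiv.trans assoc (refl⟩∘⟨ α-natural-▷ V) ⟩
    μᴳ d _ ∘ (F₀ d ◁ μᴳ x y) ∘ (k ▷ (F₀ x ⊗₀ F₀ y)) ∘ α⇒ A _ _
      ≈⟨ refl⟩∘⟨ extendʳ (▷-◁-interchange V) ⟨
    μᴳ d _ ∘ (k ▷ _) ∘ (A ◁ μᴳ x y) ∘ α⇒ A _ _ ∎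

  -- The right unit law of the lax functor, treated the same way: `k` is `π i` in `∏₁-ρ` and `p` in
  -- `ψ-ρ`.
  ρ-∘ : ∀ {d A} {k : A ⇒ F₀ d} →
        F₁ (U.ρ⇒ d) ∘ k ≈ μᴳ d U.unit ∘ (k ▷ F₀ U.unit) ∘ (A ◁ ηᴳ) ∘ ρ⇒ A
  ρ-∘ {d} {A} {k} = begin
    F₁ (U.ρ⇒ d) ∘ k                                         ≈⟨ unitᴳʳ ⟩∘⟨refl ⟩
    (μᴳ d U.unit ∘ (F₀ d ◁ ηᴳ) ∘ ρ⇒ _) ∘ k                  ≈⟨ Equiv.trans assoc (refl⟩∘⟨ assoc) ⟩
    μᴳ d U.unit ∘ (F₀ d ◁ ηᴳ) ∘ ρ⇒ _ ∘ k                    ≈⟨ refl⟩∘⟨ refl⟩∘⟨ ρ-natural ⟩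
    μᴳ d U.unit ∘ (F₀ d ◁ ηᴳ) ∘ (k ▷ unit) ∘ ρ⇒ A           ≈⟨ refl⟩∘⟨ extendʳ (▷-◁-interchange V) ⟨
    μᴳ d U.unit ∘ (k ▷ F₀ U.unit) ∘ (A ◁ ηᴳ) ∘ ρ⇒ A         ∎

  triangle-∘ : ∀ {d x A} {k : A ⇒ F₀ (d U.⊗₀ x)} →
               F₁ (d U.◁ U.λ⇒ x) ∘ F₁ (U.α⇒ d U.unit x) ∘ F₁ (U.ρ⇒ d U.▷ x) ∘ k ≈ k
  triangle-∘ {d} {x} {k = k} = begin
    F₁ (d U.◁ U.λ⇒ x) ∘ F₁ (U.α⇒ d U.unit x) ∘ F₁ (U.ρ⇒ d U.▷ x) ∘ k
      ≈⟨ refl⟩∘⟨ pullˡ (Equiv.sym homomorphism) ⟩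
    F₁ (d U.◁ U.λ⇒ x) ∘ F₁ (U.α⇒ d U.unit x G.∘ (U.ρ⇒ d U.▷ x)) ∘ k
      ≈⟨ pullˡ (Equiv.trans (Equiv.sym homomorphism)
                 (Equiv.trans (F-resp-≈ U.triangle) identity)) ⟩
    id ∘ k
      ≈⟨ identityˡ ⟩
    k ∎

  -- `χ` inherits the associativity of `μᴳ`, checked on each factor.
  ∏₁-α-χ : ∀ {d x y} →
           ∏₁ (λ i → F₁ (U.α⇒ (d i) x y)) ∘ χ (λ i → d i U.⊗₀ x) y ∘ (χ d x ▷ F₀ y)
           ≈ χ d (x U.⊗₀ y) ∘ (∏F d ◁ μᴳ x y) ∘ α⇒ (∏F d) (F₀ x) (F₀ y)
  ∏₁-α-χ {d} {x} {y} = begin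
    ∏₁ (λ i → F₁ (U.α⇒ (d i) x y)) ∘ χ _ y ∘ (χ d x ▷ F₀ y)
      ≈⟨ pullˡ ∏₁-χ ⟩
    ⟨ (λ i → F₁ (U.α⇒ (d i) x y) ∘ μᴳ _ y ∘ (π i ▷ F₀ y)) ⟩ ∘ (χ d x ▷ F₀ y)
      ≈⟨ ⟨⟩-∘ ⟩
    ⟨ (λ i → (F₁ (U.α⇒ (d i) x y) ∘ μᴳ _ y ∘ (π i ▷ F₀ y)) ∘ (χ d x ▷ F₀ y)) ⟩
      ≈⟨ ⟨⟩-cong (λ i → begin
           (F₁ (U.α⇒ (d i) x y) ∘ μᴳ _ y ∘ (π i ▷ F₀ y)) ∘ (χ d x ▷ F₀ y)
             ≈⟨ Equiv.trans assoc (refl⟩∘⟨ assoc) ⟩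
           F₁ (U.α⇒ (d i) x y) ∘ μᴳ _ y ∘ (π i ▷ F₀ y) ∘ (χ d x ▷ F₀ y)
             -- The outer projection selects the component of the inner `χ`, giving the shape that
             -- `α-μᴳ-▷` expects.
             ≈⟨ refl⟩∘⟨ refl⟩∘⟨ Equiv.trans (Equiv.sym (▷-∘ V)) (▷-resp-≈ V (π-χ i)) ⟩
           F₁ (U.α⇒ (d i) x y) ∘ μᴳ _ y ∘ ((μᴳ (d i) x ∘ (π i ▷ F₀ x)) ▷ F₀ y)
             ≈⟨ α-μᴳ-▷ ⟩
           μᴳ (d i) _ ∘ (π i ▷ _) ∘ reassociate
             ≈⟨ assoc ⟨
           (μᴳ (d i) _ ∘ (π i ▷ _)) ∘ reassociate ∎) ⟩
    ⟨ (λ i → (μᴳ (d i) (x U.⊗₀ y) ∘ (π i ▷ _)) ∘ reassociate) ⟩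
      ≈⟨ ⟨⟩-∘ ⟨
    ⟨ (λ i → μᴳ (d i) (x U.⊗₀ y) ∘ (π i ▷ _)) ⟩ ∘ reassociate
      ≈⟨ ∏₁-⟨⟩ ⟩∘⟨refl ⟨
    χ d (x U.⊗₀ y) ∘ reassociate ∎
    where
    reassociate : (∏F d ⊗₀ F₀ x) ⊗₀ F₀ y ⇒ ∏F d ⊗₀ F₀ (x U.⊗₀ y)
    reassociate = (∏F d ◁ μᴳ x y) ∘ α⇒ (∏F d) (F₀ x) (F₀ y)

    π-χ : ∀ i → π i ∘ χ d x ≈ μᴳ (d i) x ∘ (π i ▷ F₀ x)
    π-χ i = Equiv.trans (refl⟩∘⟨ ∏₁-⟨⟩) (project i)

  -- Factoring the product of unitors through `χ` lets the unit component of an operation be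
  -- evaluated on it, as in `ψ-ρ`.
  ∏₁-ρ : ∀ {d} → ∏₁ (λ i → F₁ (U.ρ⇒ (d i))) ≈ χ d U.unit ∘ (∏F d ◁ ηᴳ) ∘ ρ⇒ (∏F d)
  ∏₁-ρ {d} = begin
    ⟨ (λ i → F₁ (U.ρ⇒ (d i)) ∘ π i) ⟩
      ≈⟨ ⟨⟩-cong (λ i → Equiv.trans ρ-∘ (Equiv.sym assoc)) ⟩
    ⟨ (λ i → (μᴳ (d i) U.unit ∘ (π i ▷ _)) ∘ (∏F d ◁ ηᴳ) ∘ ρ⇒ _) ⟩
      ≈⟨ ⟨⟩-∘ ⟨
    ⟨ (λ i → μᴳ (d i) U.unit ∘ (π i ▷ _)) ⟩ ∘ (∏F d ◁ ηᴳ) ∘ ρ⇒ _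
      ≈⟨ ∏₁-⟨⟩ ⟩∘⟨refl ⟨
    χ d U.unit ∘ (∏F d ◁ ηᴳ) ∘ ρ⇒ _ ∎

  -- By the triangle identity `χ d x` makes a detour that inserts the unit between `d i` and `x`.
  -- The detour exposes the places where naturality and algebraicity of `ψ′` apply in `ψ′-χ`.
  ∏₁-triangle-χ : ∀ {d x} →
    ∏₁ (λ i → F₁ (d i U.◁ U.λ⇒ x)) ∘ ∏₁ (λ i → F₁ (U.α⇒ (d i) U.unit x))
      ∘ χ (λ i → d i U.⊗₀ U.unit) x ∘ (∏₁ (λ i → F₁ (U.ρ⇒ (d i))) ▷ F₀ x)
    ≈ χ d x
  ∏₁-triangle-χ {d} {x} = begin
    ∏λ ∘ ∏α ∘ χ _ x ∘ (∏₁ (λ i → F₁ (U.ρ⇒ (d i))) ▷ F₀ x)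
      ≈⟨ refl⟩∘⟨ refl⟩∘⟨ refl⟩∘⟨ ⊗-resp-≈ Equiv.refl identity ⟨
    ∏λ ∘ ∏α ∘ χ _ x ∘ (∏₁ (λ i → F₁ (U.ρ⇒ (d i))) ⊗₁ F₁ G.id)
      ≈⟨ refl⟩∘⟨ refl⟩∘⟨ χ-natural ⟨
    ∏λ ∘ ∏α ∘ ∏₁ (λ i → F₁ (U.ρ⇒ (d i) U.▷ x)) ∘ χ d x
      ≈⟨ refl⟩∘⟨ refl⟩∘⟨ ∏₁-χ ⟩
    ∏λ ∘ ∏α ∘ ⟨ (λ i → F₁ (U.ρ⇒ (d i) U.▷ x) ∘ μᴳ (d i) x ∘ (π i ▷ F₀ x)) ⟩
      ≈⟨ Equiv.trans (refl⟩∘⟨ ∏₁-⟨⟩) ∏₁-⟨⟩ ⟩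
    ⟨ (λ i → F₁ (d i U.◁ U.λ⇒ x) ∘ F₁ (U.α⇒ (d i) U.unit x)
               ∘ F₁ (U.ρ⇒ (d i) U.▷ x) ∘ μᴳ (d i) x ∘ (π i ▷ F₀ x)) ⟩
      ≈⟨ ⟨⟩-cong (λ _ → triangle-∘) ⟩
    ⟨ (λ i → μᴳ (d i) x ∘ (π i ▷ F₀ x)) ⟩
      ≈⟨ ∏₁-⟨⟩ ⟨
    χ d x ∎
    where
    ∏λ = ∏₁ (λ i → F₁ (d i U.◁ U.λ⇒ x))
    ∏α = ∏₁ (λ i → F₁ (U.α⇒ (d i) U.unit x))

  ∏g-natural : ∀ {d d′} (f : ∀ i → d i G.⇒ d′ i) →
               ∏g d′ ∘ ∏₁ (λ i → F₁ (f i)) ≈ ∏g d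
  ∏g-natural f = Equiv.trans ∏₁-⟨⟩ (⟨⟩-cong λ i → pullˡ (g-natural (f i)))

  -- The algebraicity of `φ`, restricted along the maps to T; it settles the half of `ψ-algebraic`
  -- that is compared over T.
  φ-∏g-χ : ∀ {d x} → φ ∘ ∏g (λ i → d i U.⊗₀ x) ∘ χ d x ≈ μ ∘ ((φ ∘ ∏g d) ⊗₁ g x)
  φ-∏g-χ {d} {x} = begin
    φ ∘ ∏g (λ i → d i U.⊗₀ x) ∘ χ d x
      ≈⟨ refl⟩∘⟨ ∏₁-χ ⟩
    φ ∘ ⟨ (λ i → g (d i U.⊗₀ x) ∘ μᴳ (d i) x ∘ (π i ▷ F₀ x)) ⟩
      ≈⟨ refl⟩∘⟨ ⟨⟩-cong (λ i → begin
           g (d i U.⊗₀ x) ∘ μᴳ (d i) x ∘ (π i ▷ F₀ x)  ≈⟨ extendʳ (g-mult (d i) x) ⟩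
           μ ∘ (g (d i) ⊗₁ g x) ∘ (π i ▷ F₀ x)         ≈⟨ refl⟩∘⟨ ⊗-absorb-▷ V ⟩
           μ ∘ ((g (d i) ∘ π i) ⊗₁ g x)
             ≈⟨ refl⟩∘⟨ ⊗-resp-≈ (project i) Equiv.refl ⟨
           μ ∘ ((π i ∘ ∏g d) ⊗₁ g x)                   ≈⟨ refl⟩∘⟨ ▷-absorb-⊗ V ⟨
           μ ∘ (π i ▷ T) ∘ (∏g d ⊗₁ g x)               ≈⟨ assoc ⟨
           (μ ∘ (π i ▷ T)) ∘ (∏g d ⊗₁ g x)             ∎) ⟩
    φ ∘ ⟨ (λ i → (μ ∘ (π i ▷ T)) ∘ (∏g d ⊗₁ g x)) ⟩
      ≈⟨ refl⟩∘⟨ ⟨⟩-∘ ⟨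
    φ ∘ ⟨ (λ i → μ ∘ (π i ▷ T)) ⟩ ∘ (∏g d ⊗₁ g x)
      ≈⟨ refl⟩∘⟨ ∏₁-⟨⟩ ⟩∘⟨refl ⟨
    φ ∘ (∏₁ (λ _ → μ) ∘ ⟨ (λ i → π i ▷ T) ⟩) ∘ (∏g d ⊗₁ g x)
      ≈⟨ extendʳ φ-algebraic ⟩
    μ ∘ (φ ▷ T) ∘ (∏g d ⊗₁ g x)
      ≈⟨ refl⟩∘⟨ ▷-absorb-⊗ V ⟩
    μ ∘ ((φ ∘ ∏g d) ⊗₁ g x) ∎

  -- The operation induced by a map out of a product.

  module _ {d : Fin n → G.Obj} {d′ : G.Obj} (p : ∏F d ⇒ F₀ d′)
           (ψ : OperationFamily P V U lax d d′)
           (ψ-χ : ∀ x → ψ x ∘ χ d x ≈ μᴳ d′ x ∘ (p ▷ F₀ x))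
           (ψ-grades : Grades P γ d d′ ψ φ)
           where

    ψ∈E : E p → ∀ x → E (ψ x)
    ψ∈E p∈E x = E-cancelʳ F (χ∈E d x)
      (E-resp-≈ (Equiv.sym (ψ-χ x)) (E-∘ μᴳ∈E (▷-closed x p∈E)))

    -- After `χ` this is interchange and naturality of `μᴳ`; over T both sides reduce to `φ ∘ ∏g`.
    ψ-natural : ∀ {x y} (h : x G.⇒ y) →
                ψ y ∘ ∏₁ (λ i → F₁ (d i U.◁ h)) ≈ F₁ (d′ U.◁ h) ∘ ψ x
    ψ-natural {x} {y} h = EM-cancel F (χ∈E d x) (g∈M (d′ U.⊗₀ y))
      (begin
        (ψ y ∘ ∏₁ (λ i → F₁ (d i U.◁ h))) ∘ χ d x   ≈⟨ assoc ⟩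
        ψ y ∘ ∏₁ (λ i → F₁ (d i U.◁ h)) ∘ χ d x     ≈⟨ refl⟩∘⟨ χ-natural-◁ ⟩
        ψ y ∘ χ d y ∘ (∏F d ◁ F₁ h)                 ≈⟨ extendʳ (ψ-χ y) ⟩
        μᴳ d′ y ∘ (p ▷ F₀ y) ∘ (∏F d ◁ F₁ h)        ≈⟨ refl⟩∘⟨ ▷-◁-interchange V ⟩
        μᴳ d′ y ∘ (F₀ d′ ◁ F₁ h) ∘ (p ▷ F₀ x)
          ≈⟨ refl⟩∘⟨ ⊗-resp-≈ identity Equiv.refl ⟩∘⟨refl ⟨
        μᴳ d′ y ∘ (F₁ G.id ⊗₁ F₁ h) ∘ (p ▷ F₀ x)    ≈⟨ extendʳ μᴳ-natural ⟩
        F₁ (d′ U.◁ h) ∘ μᴳ d′ x ∘ (p ▷ F₀ x)        ≈⟨ refl⟩∘⟨ ψ-χ x ⟨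
        F₁ (d′ U.◁ h) ∘ ψ x ∘ χ d x                 ≈⟨ assoc ⟨
        (F₁ (d′ U.◁ h) ∘ ψ x) ∘ χ d x               ∎)
      (begin
        g (d′ U.⊗₀ y) ∘ ψ y ∘ ∏₁ (λ i → F₁ (d i U.◁ h))
          ≈⟨ extendʳ (ψ-grades y) ⟩
        φ ∘ ∏g (λ i → d i U.⊗₀ y) ∘ ∏₁ (λ i → F₁ (d i U.◁ h))
          ≈⟨ refl⟩∘⟨ ∏g-natural (λ i → d i U.◁ h) ⟩
        φ ∘ ∏g (λ i → d i U.⊗₀ x)                   ≈⟨ ψ-grades x ⟨
        g (d′ U.⊗₀ x) ∘ ψ x                         ≈⟨ pullˡ (g-natural (d′ U.◁ h)) ⟨
        g (d′ U.⊗₀ y) ∘ F₁ (d′ U.◁ h) ∘ ψ x         ∎)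

    -- The source is a product tensored with `F₀ y`, so the E-map to test against is `χ d x ▷ F₀ y`.
    -- After it the equation is associativity of `μᴳ`; over T it is algebraicity of `φ`.
    ψ-algebraic : ∀ x y →
      ψ (x U.⊗₀ y) ∘ ∏₁ (λ i → F₁ (U.α⇒ (d i) x y)) ∘ χ (λ i → d i U.⊗₀ x) y
      ≈ F₁ (U.α⇒ d′ x y) ∘ μᴳ (d′ U.⊗₀ x) y ∘ (ψ x ▷ F₀ y)
    ψ-algebraic x y =
      EM-cancel F (▷-closed y (χ∈E d x)) (g∈M (d′ U.⊗₀ (x U.⊗₀ y)))
      (begin
        (ψ (x U.⊗₀ y) ∘ ∏α ∘ χ d⊗x y) ∘ (χ d x ▷ F₀ y)
          ≈⟨ Equiv.trans assoc (refl⟩∘⟨ assoc) ⟩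
        ψ (x U.⊗₀ y) ∘ ∏α ∘ χ d⊗x y ∘ (χ d x ▷ F₀ y)
          ≈⟨ refl⟩∘⟨ ∏₁-α-χ ⟩
        ψ (x U.⊗₀ y) ∘ χ d (x U.⊗₀ y) ∘ (∏F d ◁ μᴳ x y) ∘ α⇒ _ _ _
          ≈⟨ extendʳ (ψ-χ (x U.⊗₀ y)) ⟩
        μᴳ d′ (x U.⊗₀ y) ∘ (p ▷ F₀ (x U.⊗₀ y)) ∘ (∏F d ◁ μᴳ x y) ∘ α⇒ _ _ _
          ≈⟨ α-μᴳ-▷ ⟨
        F₁ (U.α⇒ d′ x y) ∘ μᴳ _ y ∘ ((μᴳ d′ x ∘ (p ▷ F₀ x)) ▷ F₀ y)
          ≈⟨ refl⟩∘⟨ refl⟩∘⟨ ▷-resp-≈ V (ψ-χ x) ⟨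
        F₁ (U.α⇒ d′ x y) ∘ μᴳ _ y ∘ ((ψ x ∘ χ d x) ▷ F₀ y)
          ≈⟨ refl⟩∘⟨ refl⟩∘⟨ ▷-∘ V ⟩
        F₁ (U.α⇒ d′ x y) ∘ μᴳ _ y ∘ (ψ x ▷ F₀ y) ∘ (χ d x ▷ F₀ y)
          ≈⟨ Equiv.trans assoc (refl⟩∘⟨ assoc) ⟨
        (F₁ (U.α⇒ d′ x y) ∘ μᴳ _ y ∘ (ψ x ▷ F₀ y)) ∘ (χ d x ▷ F₀ y) ∎)
      (begin
        g (d′ U.⊗₀ (x U.⊗₀ y)) ∘ ψ (x U.⊗₀ y) ∘ ∏α ∘ χ d⊗x y
          ≈⟨ extendʳ (ψ-grades (x U.⊗₀ y)) ⟩
        φ ∘ ∏g (λ i → d i U.⊗₀ (x U.⊗₀ y)) ∘ ∏α ∘ χ d⊗x y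
          ≈⟨ refl⟩∘⟨ pullˡ (∏g-natural (λ i → U.α⇒ (d i) x y)) ⟩
        φ ∘ ∏g (λ i → d⊗x i U.⊗₀ y) ∘ χ d⊗x y
          ≈⟨ φ-∏g-χ ⟩
        μ ∘ ((φ ∘ ∏g d⊗x) ⊗₁ g y)
          ≈⟨ refl⟩∘⟨ ⊗-resp-≈ (ψ-grades x) Equiv.refl ⟨
        μ ∘ ((g (d′ U.⊗₀ x) ∘ ψ x) ⊗₁ g y)
          ≈⟨ refl⟩∘⟨ ⊗-absorb-▷ V ⟨
        μ ∘ (g (d′ U.⊗₀ x) ⊗₁ g y) ∘ (ψ x ▷ F₀ y)
          ≈⟨ extendʳ (g-mult (d′ U.⊗₀ x) y) ⟨
        g ((d′ U.⊗₀ x) U.⊗₀ y) ∘ μᴳ _ y ∘ (ψ x ▷ F₀ y)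
          ≈⟨ pullˡ (g-natural (U.α⇒ d′ x y)) ⟨
        g (d′ U.⊗₀ (x U.⊗₀ y)) ∘ F₁ (U.α⇒ d′ x y) ∘ μᴳ _ y ∘ (ψ x ▷ F₀ y) ∎)
      where
      d⊗x = λ i → d i U.⊗₀ x
      ∏α = ∏₁ (λ i → F₁ (U.α⇒ (d i) x y))

    ψ-isGradedAlgebraic : IsGradedAlgebraic P V U lax d d′ ψ
    ψ-isGradedAlgebraic = record { natural = ψ-natural ; algebraic = ψ-algebraic }

    -- Since the unitors are invertible, this recovers `p` from the unit component of `ψ`;
    -- uniqueness of the comparison map rests on it.
    ψ-ρ : ψ U.unit ∘ ∏₁ (λ i → F₁ (U.ρ⇒ (d i))) ≈ F₁ (U.ρ⇒ d′) ∘ p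
    ψ-ρ = begin
      ψ U.unit ∘ ∏₁ (λ i → F₁ (U.ρ⇒ (d i)))                  ≈⟨ refl⟩∘⟨ ∏₁-ρ ⟩
      ψ U.unit ∘ χ d U.unit ∘ (∏F d ◁ ηᴳ) ∘ ρ⇒ _             ≈⟨ extendʳ (ψ-χ U.unit) ⟩
      μᴳ d′ U.unit ∘ (p ▷ F₀ U.unit) ∘ (∏F d ◁ ηᴳ) ∘ ρ⇒ _    ≈⟨ ρ-∘ ⟨
      F₁ (U.ρ⇒ d′) ∘ p                                       ∎

    -- Comparison with a second operation grading `φ`.

    module _ {d″ : G.Obj} (ψ′ : OperationFamily P V U lax d d″)
             (ψ′-isGradedAlgebraic : IsGradedAlgebraic P V U lax d d″ ψ′)
             (ψ′-grades : Grades P γ d d″ ψ′ φ)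
             where
      open IsGradedAlgebraic ψ′-isGradedAlgebraic

      ∏ρ : ∏F d ⇒ ∏F (λ i → d i U.⊗₀ U.unit)
      ∏ρ = ∏₁ (λ i → F₁ (U.ρ⇒ (d i)))

      open G.IsIso (U.ρ-iso d″) renaming (inv to ρ⁻¹; isoˡ to ρ⁻¹∘ρ; isoʳ to ρ∘ρ⁻¹)

      u : ∏F d ⇒ F₀ d″
      u = F₁ ρ⁻¹ ∘ ψ′ U.unit ∘ ∏ρ

      ρ-u : F₁ (U.ρ⇒ d″) ∘ u ≈ ψ′ U.unit ∘ ∏ρ
      ρ-u = Equiv.trans
        (pullˡ (Equiv.trans (Equiv.sym homomorphism)
                 (Equiv.trans (F-resp-≈ ρ∘ρ⁻¹) identity)))
        identityˡ

      -- Supplies the commuting square, with sides `p` and `u`, of which the comparison map is the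
      -- diagonal.
      g-u : g d″ ∘ u ≈ φ ∘ ∏g d
      g-u = begin
        g d″ ∘ u                                  ≈⟨ pullˡ (g-natural ρ⁻¹) ⟩
        g (d″ U.⊗₀ U.unit) ∘ ψ′ U.unit ∘ ∏ρ       ≈⟨ extendʳ (ψ′-grades U.unit) ⟩
        φ ∘ ∏g (λ i → d i U.⊗₀ U.unit) ∘ ∏ρ       ≈⟨ refl⟩∘⟨ ∏g-natural (λ i → U.ρ⇒ (d i)) ⟩
        φ ∘ ∏g d                                  ∎

      -- Puts `ψ′` in the same form as `ψ`, with `u` in the role of `p`.
      ψ′-χ : ∀ x → ψ′ x ∘ χ d x ≈ μᴳ d″ x ∘ (u ▷ F₀ x)
      ψ′-χ x = begin
        ψ′ x ∘ χ d x
          ≈⟨ refl⟩∘⟨ ∏₁-triangle-χ ⟨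
        ψ′ x ∘ ∏₁ (λ i → F₁ (d i U.◁ U.λ⇒ x)) ∘ ∏α ∘ χ d⊗I x ∘ (∏ρ ▷ F₀ x)
          ≈⟨ extendʳ (natural (U.λ⇒ x)) ⟩
        F₁ (d″ U.◁ U.λ⇒ x) ∘ ψ′ (U.unit U.⊗₀ x) ∘ ∏α ∘ χ d⊗I x ∘ (∏ρ ▷ F₀ x)
          ≈⟨ refl⟩∘⟨ Equiv.trans assoc (refl⟩∘⟨ assoc) ⟨
        F₁ (d″ U.◁ U.λ⇒ x) ∘ (ψ′ (U.unit U.⊗₀ x) ∘ ∏α ∘ χ d⊗I x) ∘ (∏ρ ▷ F₀ x)
          ≈⟨ refl⟩∘⟨ algebraic U.unit x ⟩∘⟨refl ⟩
        F₁ (d″ U.◁ U.λ⇒ x) ∘ (F₁ (U.α⇒ d″ U.unit x) ∘ μᴳ _ x ∘ (ψ′ U.unit ▷ F₀ x))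
          ∘ (∏ρ ▷ F₀ x)
          ≈⟨ refl⟩∘⟨ Equiv.trans assoc (refl⟩∘⟨ assoc) ⟩
        F₁ (d″ U.◁ U.λ⇒ x) ∘ F₁ (U.α⇒ d″ U.unit x) ∘ μᴳ _ x
          ∘ (ψ′ U.unit ▷ F₀ x) ∘ (∏ρ ▷ F₀ x)
          -- Rewriting the unit component through `u` creates a unitor at `d″`, which the triangle
          -- identity then absorbs.
          ≈⟨ refl⟩∘⟨ refl⟩∘⟨ refl⟩∘⟨ ψ′ρ▷ ⟩
        F₁ (d″ U.◁ U.λ⇒ x) ∘ F₁ (U.α⇒ d″ U.unit x) ∘ μᴳ _ x
          ∘ (F₁ (U.ρ⇒ d″) ⊗₁ F₁ G.id) ∘ (u ▷ F₀ x)
          ≈⟨ refl⟩∘⟨ refl⟩∘⟨ extendʳ μᴳ-natural ⟩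
        F₁ (d″ U.◁ U.λ⇒ x) ∘ F₁ (U.α⇒ d″ U.unit x) ∘ F₁ (U.ρ⇒ d″ U.▷ x)
          ∘ μᴳ d″ x ∘ (u ▷ F₀ x)
          ≈⟨ triangle-∘ ⟩
        μᴳ d″ x ∘ (u ▷ F₀ x) ∎
        where
        d⊗I = λ i → d i U.⊗₀ U.unit
        ∏α = ∏₁ (λ i → F₁ (U.α⇒ (d i) U.unit x))

        ψ′ρ▷ : (ψ′ U.unit ▷ F₀ x) ∘ (∏ρ ▷ F₀ x) ≈ (F₁ (U.ρ⇒ d″) ⊗₁ F₁ G.id) ∘ (u ▷ F₀ x)
        ψ′ρ▷ = begin
          (ψ′ U.unit ▷ F₀ x) ∘ (∏ρ ▷ F₀ x)           ≈⟨ ▷-∘ V ⟨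
          (ψ′ U.unit ∘ ∏ρ) ▷ F₀ x                    ≈⟨ ▷-resp-≈ V ρ-u ⟨
          (F₁ (U.ρ⇒ d″) ∘ u) ▷ F₀ x                  ≈⟨ ⊗-resp-≈ Equiv.refl identity ⟨
          (F₁ (U.ρ⇒ d″) ∘ u) ⊗₁ F₁ G.id              ≈⟨ ⊗-absorb-▷ V ⟨
          (F₁ (U.ρ⇒ d″) ⊗₁ F₁ G.id) ∘ (u ▷ F₀ x)     ∎

      -- After `χ` both sides become `u` whiskered and multiplied; over T they agree because `ψ` and
      -- `ψ′` grade the same `φ`.
      factor⇒comparison : (f : d′ G.⇒ d″) → F₁ f ∘ p ≈ u →
                          ∀ x → F₁ (f U.▷ x) ∘ ψ x ≈ ψ′ x
      factor⇒comparison f f∘p≈u x = EM-cancel F (χ∈E d x) (g∈M (d″ U.⊗₀ x))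
        (begin
          (F₁ (f U.▷ x) ∘ ψ x) ∘ χ d x                 ≈⟨ assoc ⟩
          F₁ (f U.▷ x) ∘ ψ x ∘ χ d x                   ≈⟨ refl⟩∘⟨ ψ-χ x ⟩
          F₁ (f U.▷ x) ∘ μᴳ d′ x ∘ (p ▷ F₀ x)          ≈⟨ extendʳ μᴳ-natural ⟨
          μᴳ d″ x ∘ (F₁ f ⊗₁ F₁ G.id) ∘ (p ▷ F₀ x)     ≈⟨ refl⟩∘⟨ ⊗-absorb-▷ V ⟩
          μᴳ d″ x ∘ ((F₁ f ∘ p) ⊗₁ F₁ G.id)            ≈⟨ refl⟩∘⟨ ⊗-resp-≈ f∘p≈u identity ⟩
          μᴳ d″ x ∘ (u ▷ F₀ x)                         ≈⟨ ψ′-χ x ⟨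
          ψ′ x ∘ χ d x                                 ∎)
        (begin
          g (d″ U.⊗₀ x) ∘ F₁ (f U.▷ x) ∘ ψ x   ≈⟨ pullˡ (g-natural (f U.▷ x)) ⟩
          g (d′ U.⊗₀ x) ∘ ψ x                  ≈⟨ ψ-grades x ⟩
          φ ∘ ∏g (λ i → d i U.⊗₀ x)            ≈⟨ ψ′-grades x ⟨
          g (d″ U.⊗₀ x) ∘ ψ′ x                 ∎)

      -- The unit component already determines `F₁ f ∘ p`: naturality of the unitor trades `F₁ f`
      -- for its whiskering, `ψ-ρ` brings in `ψ`, and `ρ⁻¹` turns the result into `u`.
      comparison⇒factor : (f : d′ G.⇒ d″) → F₁ (f U.▷ U.unit) ∘ ψ U.unit ≈ ψ′ U.unit →
                          F₁ f ∘ p ≈ u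
      comparison⇒factor f f-ψ = begin
        F₁ f ∘ p                                       ≈⟨ identityˡ ⟨
        id ∘ F₁ f ∘ p                                  ≈⟨ pullˡ F₁ρ⁻¹∘F₁ρ ⟨
        F₁ ρ⁻¹ ∘ F₁ (U.ρ⇒ d″) ∘ F₁ f ∘ p               ≈⟨ refl⟩∘⟨ extendʳ F₁ρ-natural ⟩
        F₁ ρ⁻¹ ∘ F₁ (f U.▷ U.unit) ∘ F₁ (U.ρ⇒ d′) ∘ p  ≈⟨ refl⟩∘⟨ refl⟩∘⟨ ψ-ρ ⟨
        F₁ ρ⁻¹ ∘ F₁ (f U.▷ U.unit) ∘ ψ U.unit ∘ ∏ρ     ≈⟨ refl⟩∘⟨ pullˡ f-ψ ⟩
        u                                              ∎
        where
        F₁ρ⁻¹∘F₁ρ : F₁ ρ⁻¹ ∘ F₁ (U.ρ⇒ d″) ≈ id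
        F₁ρ⁻¹∘F₁ρ = Equiv.trans (Equiv.sym homomorphism)
          (Equiv.trans (F-resp-≈ ρ⁻¹∘ρ) identity)

        F₁ρ-natural : F₁ (U.ρ⇒ d″) ∘ F₁ f ≈ F₁ (f U.▷ U.unit) ∘ F₁ (U.ρ⇒ d′)
        F₁ρ-natural = Equiv.trans (Equiv.sym homomorphism)
          (Equiv.trans (F-resp-≈ U.ρ-natural) homomorphism)

-- The universal operation for the graded monoid of M-subobjects of T.

theorem5p6 : ∀ {o ℓ e ε m : Level}
    (C : Category o ℓ e) (let open Category C)
    (V : Monoidal C)
    (P : FiniteProducts C) (let open FiniteProducts P)
    (𝖳 : Monoid V) (let open Monoid 𝖳)
    (F : OrthogonalFactorizationSystem C ε m) (let open OrthogonalFactorizationSystem F)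
    (η-factor : UnitFactorization 𝖳 F)
    (⊗-factor : TensorFactorizations 𝖳 F)
    (⊗-closed : TensorClosed 𝖳 F)
    (let open SliceMonoidal η-factor ⊗-factor ⊗-closed)
    (mon : IsMonoidal skewMonoidal)
    (canonical∈E : ContainsCanonical F P V)
    (∏-closed : ProductClosed F P)
    {n : ℕ} (φ : T ^ n ⇒ T) (φ-algebraic : IsAlgebraic P 𝖳 φ)
    (R : Fin n → SliceObj 𝖳 F)
    (φ-factor : Factorization (φ ∘ ∏₁ (λ i → arr (R i))))
    (let open CanonicalOperation P canonical∈E ∏-closed φ φ-algebraic R φ-factor) →
    (IsGradedAlgebraic P V (monoidal mon) T-lax R R′ ψ
    × Grades P (T-grading mon) R R′ ψ φ
    × (∀ S → E (ψ S)))
    ×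
    (∀ (R″ : SliceObj 𝖳 F)
    (ψ′ : OperationFamily P V (monoidal mon) T-lax R R″) →
    IsGradedAlgebraic P V (monoidal mon) T-lax R R″ ψ′ →
    Grades P (T-grading mon) R R″ ψ′ φ →
    ∃! (Category._≈_ (Slice 𝖳 F)) λ (f : SliceHom 𝖳 F R′ R″) →
    ∀ S → mor (f ⊠₁ Category.id (Slice 𝖳 F) {S}) ∘ ψ S ≈ ψ′ S)
theorem5p6 C V P 𝖳 F η-factor ⊗-factor ⊗-closed mon canonical∈E ∏-closed φ φ-algebraic R φ-factor =
  (ψ-isGradedAlgebraic p ψ ψ-χ ψ-grades , ψ-grades , ψ∈E p ψ ψ-χ ψ-grades p∈E) ,
  λ R″ ψ′ ψ′-isGradedAlgebraic ψ′-grades →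
    -- Both composites equal `φ ∘ ∏₁ (λ i → arr (R i))`: one by the factorization of `φ`, the other
    -- by `g-u`.
    let u-eq : arr R′ ∘ p ≈ arr R″ ∘ u p ψ ψ-χ ψ-grades ψ′ ψ′-isGradedAlgebraic ψ′-grades
        u-eq = Equiv.trans (Equiv.sym (factors φ-factor))
          (Equiv.sym (g-u p ψ ψ-χ ψ-grades ψ′ ψ′-isGradedAlgebraic ψ′-grades))
        f = lift {R′} {R″} p∈E _ u-eq
        f-β = lift-β {R′} {R″} p∈E {sq = u-eq}
    in f
     , factor⇒comparison p ψ ψ-χ ψ-grades ψ′ ψ′-isGradedAlgebraic ψ′-grades f f-β
     -- A competitor is evaluated at `J` alone, giving `mor f′ ∘ p ≈ u`; slice morphisms out of `R′`
     -- that agree after `p` are equal because both lie over T.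
     , λ {f′} f′-ψ → cancel p∈E f f′ (Equiv.trans f-β (Equiv.sym
         (comparison⇒factor p ψ ψ-χ ψ-grades ψ′ ψ′-isGradedAlgebraic ψ′-grades f′ (f′-ψ J))))
  where
  open Category C
  open Monoidal V
  open FiniteProducts P
  open OrthogonalFactorizationSystem F
  open EMFactorization
  open SliceMonoidal η-factor ⊗-factor ⊗-closed
  open CanonicalOperation P canonical∈E ∏-closed φ φ-algebraic R φ-factor
  open GradedOperations P (T-grading mon) q∈E ⊗-closed canonical∈E ∏-closed φ φ-algebraic

  p∈E : E p
  p∈E = left∈E φ-factor

  ψ-isComponent : ∀ S → IsComponent S (ψ S)
  ψ-isComponent S = proj₁ (proj₂ (component S))

  ψ-χ : ∀ S → ψ S ∘ χ R S ≈ q R′ S ∘ (p ▷ obj S)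
  ψ-χ S = proj₁ (ψ-isComponent S)

  ψ-grades : Grades P (T-grading mon) R R′ ψ φ
  ψ-grades S = proj₂ (ψ-isComponent S)
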